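{- Let $N\ge 3$ and $N=rq$ with positive integers $r,q$, and let $R$ be a set of $r$ rim vertices of the wheel graph $W_{N+1}$ (with central vertex $c$) chosen at equal intervals, i.e. all of whose cyclic intervals satisfy $d_1=d_2=\cdots=d_r=q$. Then $$\mathcal F_{W_{N+1}}(\{c\}\cup R)=\tau\bigl(W_{N+1}/(\{c\}\cup R)\bigr)=F_{2q}^{\,r}.$$
   Context: The wheel graph $W_{N+1}$ ($N\ge3$) has vertex set $\{c,v_1,\ldots,v_N\}$ and edges $\{v_i,v_{i+1}\}$ (indices modulo $N$) and $\{c,v_i\}$ for $1\le i\le N$; $c$ is the central vertex and the $v_i$ are the rim vertices. For a set $R=\{v_{a_1},\ldots,v_{a_r}\}$ of rim vertices with $1\le a_1<\cdots<a_r\le N$, the cyclic intervals are $d_i=a_{i+1}-a_i$ for $1\le i\le r-1$ and $d_r=a_1+N-a_r$. For a finite connected graph $G$ and $\varnothing\ne S\subseteq V(G)$, a rooted spanning forest of $G$ with root set $S$ is a spanning forest (an acyclic subgraph containing all vertices of $G$) in which each connected component contains exactly one vertex of $S$; $\mathcal F_G(S)$ denotes the number of such forests. $G/S$ is the multigraph obtained from $G$ by identifying all vertices of $S$ into a single vertex, keeping multiple edges with their multiplicities and deleting loops (when $S=V(G)$ this is a single vertex). $\tau(H)$ is the number of spanning trees of $H$, where parallel edges are regarded as distinct. Fibonacci numbers: $F_0=0$, $F_1=1$, $F_{n+2}=F_{n+1}+F_n$. -}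

module Defs where

open import Data.Fin.Base using (Fin; zero; suc; toℕ; fromℕ<; punchIn)
open import Data.Fin.Properties using (_≟_; any?; all?; injective⇒≤; toℕ-fromℕ<)
open import Data.Fin.Subset using (Subset; inside; outside; _∈_; ∁; ∣_∣)
open import Data.Fin.Subset.Properties using (_∈?_)
open import Data.List.Base using (List; []; _∷_; _++_; map; filter; length; lookup; allFin)
open import Data.List.Membership.Propositional using () renaming (_∈_ to _∈ₗ_)
open import Data.List.Membership.Propositional.Properties using (∈-allFin)
open import Data.List.Relation.Unary.Any using (here; there)
open import Data.Nat.Base using (ℕ; zero; suc; _+_; _∸_)
open import Data.Nat.DivMod using (_mod_)
open import Data.Product.Base using (∃; _×_; _,_; proj₁; proj₂; uncurry)
import Data.Product.Base as Product
open import Data.Product.Properties using (≡-dec)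
open import Data.Sum.Base using (_⊎_; inj₁; inj₂)
open import Data.Vec.Base as Vec using (Vec; tabulate)
open import Data.Vec.Properties using (lookup∘tabulate)
open import Function.Base using (_∘_)
open import Function.Definitions using (Injective)
open import Relation.Binary.Construct.Closure.ReflexiveTransitive using (Star; ε; _◅_; _◅◅_)
open import Relation.Binary.PropositionalEquality
  using (_≡_; refl; sym; trans; subst; subst₂)
open import Relation.Nullary.Decidable using (Dec; map′; ¬?; _×-dec_; _⊎-dec_; _→-dec_)
open import Relation.Nullary.Negation using (¬_)
open import Relation.Unary using (Decidable)

-- The edge set is the set of positions in the list `edges`, so repeated pairs
-- are distinct parallel edges.  The order of the two ends of an edge carries
-- no meaning (see `Joins`).
record Multigraph : Set where
  constructor multigraph
  field
    order : ℕ
    edges : List (Fin order × Fin order)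

  Vertex : Set
  Vertex = Fin order

  size : ℕ
  size = length edges

  Edge : Set
  Edge = Fin size

  -- A set of edges stands for the spanning subgraph having these edges.
  EdgeSet : Set
  EdgeSet = Subset size

  Joins : Edge → Vertex → Vertex → Set
  Joins e u v = lookup edges e ≡ (u , v) ⊎ lookup edges e ≡ (v , u)

  Adjacent : EdgeSet → Vertex → Vertex → Set
  Adjacent F u v = ∃ λ e → e ∈ F × Joins e u v

  SameComponent : EdgeSet → Vertex → Vertex → Set
  SameComponent F = Star (Adjacent F)

  Connected : EdgeSet → Set
  Connected F = ∀ u v → SameComponent F u v

-- Cyclic successor modulo n.
next : ∀ {n} → Fin n → Fin n
next {suc n} i = suc (toℕ i) mod suc n

-- A cycle of length k+1 visits distinct vertices vertex 0, …, vertex k through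
-- distinct edges, edge i joining vertex i to its cyclic successor.  A loop is
-- a cycle of length 1 and two parallel edges form a cycle of length 2.
module _ (G : Multigraph) where
  open Multigraph G

  record IsCycle (F : EdgeSet) {k : ℕ}
                 (vertex : Fin (suc k) → Vertex) (edge : Fin (suc k) → Edge) : Set where
    constructor isCycle
    field
      vertex-injective : Injective _≡_ _≡_ vertex
      edge-injective   : Injective _≡_ _≡_ edge
      edge∈F           : ∀ i → edge i ∈ F
      joins            : ∀ i → Joins (edge i) (vertex i) (vertex (next i))

  HasCycle : EdgeSet → Set
  HasCycle F = ∃ λ k → ∃ λ (vertex : Fin (suc k) → Vertex) →
    ∃ λ (edge : Fin (suc k) → Edge) → IsCycle F vertex edge

  Acyclic : EdgeSet → Set
  Acyclic F = ¬ HasCycle F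

  IsSpanningTree : EdgeSet → Set
  IsSpanningTree F = Acyclic F × Connected F

  -- The second component says that the component of every vertex v contains
  -- exactly one vertex of S.
  IsRootedSpanningForest : Subset order → EdgeSet → Set
  IsRootedSpanningForest S F = Acyclic F ×
    (∀ v → ∃ λ s → (s ∈ S × SameComponent F v s) ×
                   (∀ t → t ∈ S × SameComponent F v t → s ≡ t))

-- Decidability of these notions, needed only to count.

-- Warshall's algorithm: Via R ps x y says that y can be reached from x with
-- all intermediate points in ps.
private
  Via : ∀ {n} → (Fin n → Fin n → Set) → List (Fin n) → Fin n → Fin n → Set
  Via R []       x y = x ≡ y ⊎ R x y
  Via R (p ∷ ps) x y = Via R ps x y ⊎ (Via R ps x p × Via R ps p y)

  module _ {n} {R : Fin n → Fin n → Set} where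

    via? : (∀ x y → Dec (R x y)) → ∀ ps x y → Dec (Via R ps x y)
    via? R? []       x y = (x ≟ y) ⊎-dec R? x y
    via? R? (p ∷ ps) x y = via? R? ps x y ⊎-dec (via? R? ps x p ×-dec via? R? ps p y)

    via⇒star : ∀ ps {x y} → Via R ps x y → Star R x y
    via⇒star []       (inj₁ refl)    = ε
    via⇒star []       (inj₂ r)       = r ◅ ε
    via⇒star (p ∷ ps) (inj₁ v)       = via⇒star ps v
    via⇒star (p ∷ ps) (inj₂ (v , w)) = via⇒star ps v ◅◅ via⇒star ps w

    via-base : ∀ ps {x y} → x ≡ y ⊎ R x y → Via R ps x y
    via-base []       b = b
    via-base (p ∷ ps) b = inj₁ (via-base ps b)

    via-trans : ∀ ps {x y z} → y ∈ₗ ps → Via R ps x y → Via R ps y z → Via R ps x z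
    via-trans (p ∷ ps) {x} {z = z} (here refl) v w = inj₂ (to v , from w)
      where
      to : Via R (p ∷ ps) x p → Via R ps x p
      to (inj₁ a)       = a
      to (inj₂ (a , _)) = a
      from : Via R (p ∷ ps) p z → Via R ps p z
      from (inj₁ a)       = a
      from (inj₂ (_ , a)) = a
    via-trans (p ∷ ps) (there m) (inj₁ a)       (inj₁ b)       = inj₁ (via-trans ps m a b)
    via-trans (p ∷ ps) (there m) (inj₁ a)       (inj₂ (b , c)) = inj₂ (via-trans ps m a b , c)
    via-trans (p ∷ ps) (there m) (inj₂ (a , b)) (inj₁ c)       = inj₂ (a , via-trans ps m b c)
    via-trans (p ∷ ps) (there m) (inj₂ (a , _)) (inj₂ (_ , d)) = inj₂ (a , d)

    star⇒via : ∀ {x y} → Star R x y → Via R (allFin n) x y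
    star⇒via ε        = via-base (allFin n) (inj₁ refl)
    star⇒via (r ◅ rs) =
      via-trans (allFin n) (∈-allFin _) (via-base (allFin n) (inj₂ r)) (star⇒via rs)

    star? : (∀ x y → Dec (R x y)) → ∀ x y → Dec (Star R x y)
    star? R? x y = map′ (via⇒star (allFin n)) star⇒via (via? R? (allFin n) x y)

  anyVec? : ∀ {n} k {P : Vec (Fin n) k → Set} → Decidable P → Dec (∃ P)
  anyVec? zero    P? = map′ (λ p → Vec.[] , p) (λ { (Vec.[] , p) → p }) (P? Vec.[])
  anyVec? (suc k) P? =
    map′ (λ { (x , xs , p) → x Vec.∷ xs , p }) (λ { (x Vec.∷ xs , p) → x , xs , p })
         (any? λ x → anyVec? k (P? ∘ (x Vec.∷_)))

  injective? : ∀ {m n} (f : Fin m → Fin n) → Dec (Injective _≡_ _≡_ f)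
  injective? f = map′ (λ h {x} {y} → h x y) (λ h x y → h)
                      (all? λ x → all? λ y → (f x ≟ f y) →-dec (x ≟ y))

module _ (G : Multigraph) where
  open Multigraph G

  joins? : ∀ e u v → Dec (Joins e u v)
  joins? e u v = ≡-dec _≟_ _≟_ (lookup edges e) (u , v)
         ⊎-dec ≡-dec _≟_ _≟_ (lookup edges e) (v , u)

  adjacent? : ∀ F u v → Dec (Adjacent F u v)
  adjacent? F u v = any? λ e → (e ∈? F) ×-dec joins? e u v

  sameComponent? : ∀ F u v → Dec (SameComponent F u v)
  sameComponent? F = star? (adjacent? F)

  connected? : Decidable Connected
  connected? F = all? λ u → all? λ v → sameComponent? F u v

  isCycle? : ∀ F {k} vertex edge → Dec (IsCycle G F {k} vertex edge)
  isCycle? F vertex edge =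
    map′ to from
         (injective? vertex ×-dec injective? edge ×-dec
          (all? λ i → edge i ∈? F) ×-dec
          (all? λ i → joins? (edge i) (vertex i) (vertex (next i))))
    where
    Fields : Set
    Fields = Injective _≡_ _≡_ vertex × Injective _≡_ _≡_ edge ×
             (∀ i → edge i ∈ F) × (∀ i → Joins (edge i) (vertex i) (vertex (next i)))
    to : Fields → IsCycle G F vertex edge
    to (a , b , c , d) = isCycle a b c d
    from : IsCycle G F vertex edge → Fields
    from (isCycle a b c d) = a , b , c , d

  private
    isCycle-resp : ∀ {F k} {v v′ : Fin (suc k) → Vertex} {e e′ : Fin (suc k) → Edge} →
                   (∀ i → v i ≡ v′ i) → (∀ i → e i ≡ e′ i) →
                   IsCycle G F v e → IsCycle G F v′ e′
    isCycle-resp {F} {v′ = v′} {e′ = e′} p q (isCycle a b c d) = isCycle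
      (λ h → a (trans (p _) (trans h (sym (p _)))))
      (λ h → b (trans (q _) (trans h (sym (q _)))))
      (λ i → subst (_∈ F) (q i) (c i))
      (λ i → subst (λ x → Joins x (v′ i) (v′ (next i))) (q i)
               (subst₂ (Joins _) (p i) (p (next i)) (d i)))

    CycleOfLength : EdgeSet → ℕ → Set
    CycleOfLength F k = ∃ λ (vs : Vec Vertex (suc k)) → ∃ λ (es : Vec Edge (suc k)) →
      IsCycle G F (Vec.lookup vs) (Vec.lookup es)

    cycleOfLength? : ∀ F k → Dec (CycleOfLength F k)
    cycleOfLength? F k = anyVec? (suc k) λ vs → anyVec? (suc k) λ es →
      isCycle? F (Vec.lookup vs) (Vec.lookup es)

    bounded⇒hasCycle : ∀ {F} → ∃ (λ (k : Edge) → CycleOfLength F (toℕ k)) → HasCycle G F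
    bounded⇒hasCycle (k , vs , es , c) = toℕ k , Vec.lookup vs , Vec.lookup es , c

    hasCycle⇒bounded : ∀ {F} → HasCycle G F → ∃ (λ (k : Edge) → CycleOfLength F (toℕ k))
    hasCycle⇒bounded {F} (k , v , e , c) =
      fromℕ< k<size , subst (CycleOfLength F) (sym (toℕ-fromℕ< k<size))
        (tabulate v , tabulate e ,
         isCycle-resp (λ i → sym (lookup∘tabulate v i)) (λ i → sym (lookup∘tabulate e i)) c)
      where k<size = injective⇒≤ (IsCycle.edge-injective c)

  acyclic? : Decidable (Acyclic G)
  acyclic? F =
    ¬? (map′ bounded⇒hasCycle hasCycle⇒bounded (any? λ k → cycleOfLength? F (toℕ k)))

  isSpanningTree? : Decidable (IsSpanningTree G)
  isSpanningTree? F = acyclic? F ×-dec connected? F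

  isRootedSpanningForest? : ∀ S → Decidable (IsRootedSpanningForest G S)
  isRootedSpanningForest? S F = acyclic? F ×-dec
    (all? λ v → any? λ s → ((s ∈? S) ×-dec sameComponent? F v s) ×-dec
      (all? λ t → ((t ∈? S) ×-dec sameComponent? F v t) →-dec (s ≟ t)))

allSubsets : ∀ n → List (Subset n)
allSubsets zero    = Vec.[] ∷ []
allSubsets (suc n) = map (outside Vec.∷_) (allSubsets n) ++ map (inside Vec.∷_) (allSubsets n)

#subsets : ∀ {n} {P : Subset n → Set} → Decidable P → ℕ
#subsets {n} P? = length (filter P? (allSubsets n))

τ : Multigraph → ℕ
τ G = #subsets (isSpanningTree? G)

𝓕 : (G : Multigraph) → Subset (Multigraph.order G) → ℕ
𝓕 G S = #subsets (isRootedSpanningForest? G S)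

-- All vertices of S go to the vertex 0; the vertices outside S go, in order, to
-- 1, …, ∣ ∁ S ∣.  Here punchIn (suc zero) skips the value 1.
contract : ∀ {n} (S : Subset n) → Fin n → Fin (suc ∣ ∁ S ∣)
contract (inside  Vec.∷ S) zero    = zero
contract (inside  Vec.∷ S) (suc v) = contract S v
contract (outside Vec.∷ S) zero    = suc zero
contract (outside Vec.∷ S) (suc v) = punchIn (suc zero) (contract S v)

-- G / S identifies the vertices of S, keeps multiplicities and deletes loops.
-- It is only meant for S nonempty: for S empty, the vertex 0 would be a
-- superfluous isolated vertex.
infixl 7 _/_
_/_ : (G : Multigraph) → Subset (Multigraph.order G) → Multigraph
multigraph n es / S = multigraph (suc ∣ ∁ S ∣)
  (filter (λ e → ¬? (proj₁ e ≟ proj₂ e))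
    (map (Product.map (contract S) (contract S)) es))

-- The wheel on N+1 vertices: the centre is zero and suc i is the rim vertex
-- with (0-based) index i.
wheel : ℕ → Multigraph
wheel N = multigraph (suc N)
  (map (λ i → suc i , suc (next i)) (allFin N) ++ map (λ i → zero , suc i) (allFin N))

centreAnd : ∀ {N} → Subset N → Subset (suc N)
centreAnd R = inside Vec.∷ R

-- The indices of the elements of a set of rim vertices, in increasing order.
indices : ∀ {N} → Subset N → List ℕ
indices {N} R = map toℕ (filter (_∈? R) (allFin N))

-- For a₁ < … < aᵣ, the list a₂ - a₁, …, aᵣ - aᵣ₋₁, a₁ + N - aᵣ.  As only
-- differences occur, starting the indices at 0 instead of 1 is immaterial.
cyclicIntervals : ∀ {N} → Subset N → List ℕ
cyclicIntervals {N} R = start (indices R)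
  where
  go : ℕ → ℕ → List ℕ → List ℕ
  go a₁ a []       = (a₁ + N ∸ a) ∷ []
  go a₁ a (b ∷ bs) = (b ∸ a) ∷ go a₁ b bs

  start : List ℕ → List ℕ
  start []       = []
  start (a ∷ as) = go a a as

fib : ℕ → ℕ
fib 0             = 0
fib 1             = 1
fib (suc (suc n)) = fib (suc n) + fib n

module Submission where

open import Defs
open import Data.Bool.Base using (true; false)
open import Data.Fin.Base as Fin using (Fin; zero; suc; toℕ; fromℕ; inject₁; punchIn; punchOut)
open import Data.Fin.Induction using (>-weakInduction)
import Data.Fin.Properties as Fin
open import Data.Fin.Relation.Unary.Top using (view; ‵fromℕ; ‵inject₁)
open import Data.Fin.Subset using (Subset; inside; outside; ∣_∣; _∈_; _∉_; _⊆_; ∁)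
open import Data.Fin.Subset.Properties using (_∈?_; drop-there; ∣∁p∣≡n∸∣p∣; Empty-unique; ∣⊥∣≡0)
open import Data.List.Base as List
  using (List; []; _∷_; _++_; _∷ʳ_; map; filter; length; lookup; tabulate; allFin)
open import Data.List.Membership.Propositional using () renaming (_∈_ to _∈ₗ_)
open import Data.List.Membership.Propositional.Properties
  using (∈-allFin; ∈-map⁺; ∈-map⁻; ∈-filter⁺; ∈-filter⁻)
open import Data.List.Properties
  using (length-map; length-++; filter-++; filter-none; filter-accept; map-id-local; tabulate-cong)
open import Data.List.Relation.Binary.Permutation.Propositional
  using (_↭_; prep; swap; refl; ↭-refl; ↭-sym; ↭-trans; ↭-reflexive; ↭⇒↭ₛ) renaming (trans to trans↭)
open import Data.List.Relation.Binary.Permutation.Propositional.Properties using (∷↭∷ʳ; shift; map⁺; ++⁺)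
open import Data.List.Relation.Binary.Permutation.Setoid.Properties using (Unique-resp-↭)
open import Data.List.Relation.Unary.All as All using (All; []; _∷_; universal)
import Data.List.Relation.Unary.All.Properties as All
open import Data.List.Relation.Unary.AllPairs using ([]; _∷_)
open import Data.List.Relation.Unary.Any using (here; there)
open import Data.List.Relation.Unary.Unique.Propositional using (Unique)
open import Data.List.Relation.Unary.Unique.Propositional.Properties using (allFin⁺)
open import Data.Nat.Base hiding (_/_)
open import Data.Nat.DivMod hiding (_/_)
open import Data.Nat.Divisibility using (_∣_; divides; ∣m+n∣m⇒∣n; n∣m*n; >⇒∤)
open import Data.Nat.GeneralisedArithmetic using (iterate)
open import Data.Nat.Properties
open import Data.Product.Base as Product using (∃; _×_; _,_; proj₁; proj₂)
open import Data.Sum.Base as Sum using (_⊎_; inj₁; inj₂)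
open import Data.Unit.Base using (⊤; tt)
open import Data.Vec.Base using ([]; _∷_; _[_]≔_; here; there)
open import Data.Vec.Properties using ([]≔-minimal)
open import Function.Base using (_∘_; id)
open import Level using (0ℓ)
open import Relation.Binary.Construct.Closure.ReflexiveTransitive
  using (ε; _◅_; _◅◅_; fold; reverse)
import Relation.Binary.Construct.On as On
open import Relation.Binary.Core using (Rel; _⇒_)
open import Relation.Binary.PropositionalEquality
open import Relation.Binary.Structures using (IsEquivalence)
open import Relation.Nullary
open import Relation.Unary using (Decidable)

-- Deletion–contraction.  Feed the edges of a chosen set one by one to union-find:
-- the set is acyclic iff no edge joins two vertices already in one class, and it
-- is connected iff a single class is left.  Starting from the partition whose
-- only nontrivial class is S, the same criterion describes the forests rooted at
-- S and the spanning trees of G / S, so both are counted by one recursion on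
-- the list of edges.  That recursion does not depend on the order of the edges, so the
-- wheel may be traversed from a root around the rim, each rim edge being followed
-- by the next spoke.  Let A and B count the completions when the current rim vertex
-- is, respectively is not, joined to the root yet.  A non-root vertex acts by
-- (A , B) ↦ (2A + B , A + B), a root by (A , B) ↦ (A , A), and so q - 1
-- non-roots followed by a root multiply A by fib (2 * q).

private variable
  A V W : Set
  k n N : ℕ
  es fs : List (V × V)

-- Union-find along a list of edges

relabel : ℕ → ℕ → ℕ → ℕ
relabel a b x with x ≟ b
... | yes _ = a
... | no  _ = x

relabel-left : ∀ a b → relabel a b a ≡ a
relabel-left a b with a ≟ b
... | yes _ = refl
... | no  _ = refl

relabel-right : ∀ a b → relabel a b b ≡ a
relabel-right a b with b ≟ b
... | yes _  = refl
... | no b≢b = contradiction refl b≢b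

relabel-other : ∀ {a b x} → x ≢ b → relabel a b x ≡ x
relabel-other {b = b} {x} x≢b with x ≟ b
... | yes x≡b = contradiction x≡b x≢b
... | no  _   = refl

relabel-kernel : ∀ {a b} x y → relabel a b x ≡ relabel a b y →
                 x ≡ y ⊎ (x ≡ a × y ≡ b) ⊎ (x ≡ b × y ≡ a)
relabel-kernel {b = b} x y eq with x ≟ b | y ≟ b
... | yes x≡b | yes y≡b = inj₁ (trans x≡b (sym y≡b))
... | yes x≡b | no  _   = inj₂ (inj₂ (x≡b , sym eq))
... | no  _   | yes y≡b = inj₂ (inj₁ (eq , y≡b))
... | no  _   | no  _   = inj₁ eq

-- A labelling stands for the partition of the vertices into its fibres, and
-- merging is the union step of union-find.
Ker : (V → ℕ) → Rel V 0ℓ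
Ker π x y = π x ≡ π y

ker-isEquivalence : (π : V → ℕ) → IsEquivalence (Ker π)
ker-isEquivalence π = On.isEquivalence π isEquivalence

merge : (V → ℕ) → V → V → V → ℕ
merge π u v = relabel (π u) (π v) ∘ π

ker⊆merge : (π : V → ℕ) (u v : V) → Ker π ⇒ Ker (merge π u v)
ker⊆merge π u v = cong (relabel (π u) (π v))

merge-joins : (π : V → ℕ) (u v : V) → Ker (merge π u v) u v
merge-joins π u v = trans (relabel-left (π u) (π v)) (sym (relabel-right (π u) (π v)))

merge-kernel : (π : V → ℕ) (u v : V) → ∀ {x y} → Ker (merge π u v) x y →
               Ker π x y ⊎ (Ker π x u × Ker π y v) ⊎ (Ker π x v × Ker π y u)
merge-kernel π u v {x} {y} = relabel-kernel (π x) (π y)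

-- Minimality, together with `ker⊆merge` and `merge-joins`, determines the kernel of a merge.
-- `merge-mono`, `merge-sym` and `merge-comm` follow from these facts without a look at label
-- values.
merge-least : {R : Rel V 0ℓ} → IsEquivalence R → {π : V → ℕ} {u v : V} →
              Ker π ⇒ R → R u v → Ker (merge π u v) ⇒ R
merge-least E {π} {u} {v} π⊆R uRv p with merge-kernel π u v p
... | inj₁ x~y                = π⊆R x~y
... | inj₂ (inj₁ (x~u , y~v)) = R.trans (π⊆R x~u) (R.trans uRv (R.sym (π⊆R y~v)))
  where module R = IsEquivalence E
... | inj₂ (inj₂ (x~v , y~u)) = R.trans (π⊆R x~v) (R.trans (R.sym uRv) (R.sym (π⊆R y~u)))
  where module R = IsEquivalence E

merge-mono : {π ρ : V → ℕ} (u v : V) → Ker π ⇒ Ker ρ → Ker (merge π u v) ⇒ Ker (merge ρ u v)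
merge-mono {π = π} {ρ} u v π⊆ρ =
  merge-least (ker-isEquivalence (merge ρ u v)) (ker⊆merge ρ u v ∘ π⊆ρ) (merge-joins ρ u v)

merge-sym : (π : V → ℕ) (u v : V) → Ker (merge π u v) ⇒ Ker (merge π v u)
merge-sym π u v =
  merge-least (ker-isEquivalence (merge π v u)) (ker⊆merge π v u) (sym (merge-joins π v u))

merge-comm : (π : V → ℕ) (u v x y : V) →
             Ker (merge (merge π u v) x y) ⇒ Ker (merge (merge π x y) u v)
merge-comm π u v x y = merge-least E
  (merge-least E (ker⊆merge (merge π x y) u v ∘ ker⊆merge π x y) (merge-joins (merge π x y) u v))
  (ker⊆merge (merge π x y) u v (merge-joins π x y))
  where E = ker-isEquivalence (merge (merge π x y) u v)

-- The exchange property of the graphic matroid: if merging `x` and `y` is what joins `u` to `v`,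
-- the connection crosses that pair, so it can be solved for `x` and `y` instead.
merge-exchange : (π : V → ℕ) (u v x y : V) → ¬ Ker π u v →
                 Ker (merge π x y) u v → Ker (merge π u v) x y
merge-exchange π u v x y u≁v p with merge-kernel π x y p
... | inj₁ u~v                = contradiction u~v u≁v
... | inj₂ (inj₁ (u~x , v~y)) =
  trans (ker⊆merge π u v (sym u~x)) (trans (merge-joins π u v) (ker⊆merge π u v v~y))
... | inj₂ (inj₂ (u~y , v~x)) =
  trans (ker⊆merge π u v (sym v~x)) (trans (sym (merge-joins π u v)) (ker⊆merge π u v u~y))

run : (V → ℕ) → (es : List (V × V)) → Subset (length es) → V → ℕ
run π []             []            = π
run π (_ ∷ es)       (outside ∷ F) = run π es F
run π ((u , v) ∷ es) (inside ∷ F)  = run (merge π u v) es F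

Forest : (V → ℕ) → (es : List (V × V)) → Subset (length es) → Set
Forest π []             []            = ⊤
Forest π (_ ∷ es)       (outside ∷ F) = Forest π es F
Forest π ((u , v) ∷ es) (inside ∷ F)  = ¬ Ker π u v × Forest (merge π u v) es F

source target : (es : List (V × V)) → Fin (length es) → V
source es e = proj₁ (lookup es e)
target es e = proj₂ (lookup es e)

ker⊆run : (π : V → ℕ) (es : List (V × V)) (F : Subset (length es)) →
          Ker π ⇒ Ker (run π es F)
ker⊆run π []             []            = id
ker⊆run π (_ ∷ es)       (outside ∷ F) = ker⊆run π es F
ker⊆run π ((u , v) ∷ es) (inside ∷ F)  = ker⊆run (merge π u v) es F ∘ ker⊆merge π u v

run-joins : (π : V → ℕ) (es : List (V × V)) (F : Subset (length es)) →
            ∀ {e} → e ∈ F → Ker (run π es F) (source es e) (target es e)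
run-joins π ((u , v) ∷ es) (inside ∷ F)  here        = ker⊆run _ es F (merge-joins π u v)
run-joins π (_ ∷ es)       (outside ∷ F) (there e∈F) = run-joins π es F e∈F
run-joins π ((u , v) ∷ es) (inside ∷ F)  (there e∈F) = run-joins (merge π u v) es F e∈F

run-least : {R : Rel V 0ℓ} → IsEquivalence R → {π : V → ℕ} (es : List (V × V))
            (F : Subset (length es)) → Ker π ⇒ R →
            (∀ {e} → e ∈ F → R (source es e) (target es e)) → Ker (run π es F) ⇒ R
run-least E []             []            π⊆R _   = π⊆R
run-least E (_ ∷ es)       (outside ∷ F) π⊆R F⊆R = run-least E es F π⊆R (F⊆R ∘ there)
run-least E {π} ((u , v) ∷ es) (inside ∷ F)  π⊆R F⊆R =
  run-least E es F (merge-least E {π} π⊆R (F⊆R here)) (F⊆R ∘ there)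

-- A finer partition keeps more pairs apart and merging preserves the inclusion, so every test
-- passed from the coarser start is passed from the finer one.
forest-antitone : {π ρ : V → ℕ} (es : List (V × V)) (F : Subset (length es)) →
                  Ker π ⇒ Ker ρ → Forest ρ es F → Forest π es F
forest-antitone []             []            π⊆ρ _         = tt
forest-antitone (_ ∷ es)       (outside ∷ F) π⊆ρ f         = forest-antitone es F π⊆ρ f
forest-antitone ((u , v) ∷ es) (inside ∷ F)  π⊆ρ (u≁v , f) =
  u≁v ∘ π⊆ρ , forest-antitone es F (merge-mono u v π⊆ρ) f

-- An edge processed first may as well be processed last.
forest-separates : {π : V → ℕ} {u v : V} (es : List (V × V)) (F : Subset (length es)) →
                   ¬ Ker π u v → Forest (merge π u v) es F → ¬ Ker (run π es F) u v
forest-separates []             []            u≁v _         = u≁v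
forest-separates (_ ∷ es)       (outside ∷ F) u≁v f         = forest-separates es F u≁v f
forest-separates {π = π} {u} {v} ((x , y) ∷ es) (inside ∷ F) u≁v (x≁y , f) =
  forest-separates es F (x≁y ∘ merge-exchange π u v x y u≁v)
    (forest-antitone es F (merge-comm π x y u v) f)

-- The order-free form of the criterion: when the recursion reaches `e`, the earlier edges are
-- already in the labelling, and `forest-separates` moves `e` behind the later ones.
forest-irredundant : {π : V → ℕ} (es : List (V × V)) (F : Subset (length es)) →
                     Forest π es F → ∀ {e} → e ∈ F →
                     ¬ Ker (run π es (F [ e ]≔ outside)) (source es e) (target es e)
forest-irredundant ((u , v) ∷ es) (inside ∷ F)  (u≁v , f) here        = forest-separates es F u≁v f
forest-irredundant (_ ∷ es)       (outside ∷ F) f         (there e∈F) = forest-irredundant es F f e∈F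
forest-irredundant (_ ∷ es)       (inside ∷ F)  (_ , f)   (there e∈F) = forest-irredundant es F f e∈F

Redundant : (V → ℕ) → (es : List (V × V)) → Subset (length es) → Set
Redundant π es F =
  ∃ λ e → e ∈ F × Ker (run π es (F [ e ]≔ outside)) (source es e) (target es e)

-- The first edge to fail the test has its ends joined by the start and the earlier edges. Later
-- edges only coarsen the partition, so that edge is redundant.
forest-or-redundant : (π : V → ℕ) (es : List (V × V)) (F : Subset (length es)) →
                      Forest π es F ⊎ Redundant π es F
forest-or-redundant π [] [] = inj₁ tt
forest-or-redundant π (_ ∷ es) (outside ∷ F) with forest-or-redundant π es F
... | inj₁ f             = inj₁ f
... | inj₂ (e , e∈F , p) = inj₂ (suc e , there e∈F , p)
forest-or-redundant π ((u , v) ∷ es) (inside ∷ F) with π u ≟ π v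
... | yes u~v = inj₂ (zero , here , ker⊆run π es F u~v)
... | no  u≁v with forest-or-redundant (merge π u v) es F
...   | inj₁ f             = inj₁ (u≁v , f)
...   | inj₂ (e , e∈F , p) = inj₂ (suc e , there e∈F , p)

irredundant⇒forest : (π : V → ℕ) (es : List (V × V)) (F : Subset (length es)) →
                     ¬ Redundant π es F → Forest π es F
irredundant⇒forest π es F ¬r with forest-or-redundant π es F
... | inj₁ f = f
... | inj₂ r = contradiction r ¬r

-- Counting by deletion and contraction

-- The decision is an argument so that proofs can match on it. If `k` is one less than the number of
-- classes, `k = 0` leaves no separated pair; 0 is the default there.
contractBy : {A : Set} → Dec A → ℕ → (ℕ → ℕ) → ℕ
contractBy (yes _) _       _ = 0
contractBy (no _)  zero    _ = 0
contractBy (no _)  (suc k) c = c k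

-- Meant for k one less than the number of classes of π.
count : ℕ → (V → ℕ) → List (V × V) → ℕ
count k π []             = 0 ^ k
count k π ((u , v) ∷ es) =
  count k π es + contractBy (π u ≟ π v) k (λ j → count j (merge π u v) es)

contractBy-cong : ∀ {A B : Set} (a : Dec A) (b : Dec B) → (A → B) → (B → A) →
                  ∀ k {c d} → (∀ j → c j ≡ d j) → contractBy a k c ≡ contractBy b k d
contractBy-cong (yes _) (yes _) f g k       p = refl
contractBy-cong (yes a) (no ¬b) f g k       p = contradiction (f a) ¬b
contractBy-cong (no ¬a) (yes b) f g k       p = contradiction (g b) ¬a
contractBy-cong (no _)  (no _)  f g zero    p = refl
contractBy-cong (no _)  (no _)  f g (suc k) p = p k

count-cong : {π ρ : V → ℕ} → Ker π ⇒ Ker ρ → Ker ρ ⇒ Ker π →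
             ∀ k es → count k π es ≡ count k ρ es
count-cong f g k []             = refl
count-cong {π = π} {ρ} f g k ((u , v) ∷ es) = cong₂ _+_ (count-cong f g k es)
  (contractBy-cong (π u ≟ π v) (ρ u ≟ ρ v) f g k
    (λ j → count-cong (merge-mono u v f) (merge-mono u v g) j es))

count-loop : ∀ k (π : V → ℕ) u v es → Ker π u v → count k π ((u , v) ∷ es) ≡ count k π es
count-loop k π u v es u~v with π u ≟ π v
... | yes _   = +-identityʳ _
... | no  u≁v = contradiction u~v u≁v

count-map : ∀ k (π : W → ℕ) (f : V → W) es →
            count k π (map (λ (u , v) → f u , f v) es) ≡ count k (π ∘ f) es
count-map k π f []             = refl
count-map k π f ((u , v) ∷ es) = cong₂ _+_ (count-map k π f es)
  (contractBy-cong (π (f u) ≟ π (f v)) (π (f u) ≟ π (f v)) id id k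
    (λ j → count-map j (merge π (f u) (f v)) f es))


-- The core of `count-swap`: `A` and `B` say that the first and the second edge are redundant at the
-- start, `C` and `D` that they are so after the other edge. By exchange `C` and `D` agree when `A`
-- and `B` fail, so both orders admit taking both edges alike.
contractBy-swap : {A B C D : Set} (a : Dec A) (b : Dec B) (c : Dec C) (d : Dec D) →
                  (A → C) → (B → D) → (¬ B → D → C) → (¬ A → C → D) →
                  ∀ k {s t m n : ℕ → ℕ} → (∀ j → m j ≡ n j) →
                  contractBy b k t + contractBy a k (λ j → s j + contractBy d j m) ≡
                  contractBy a k s + contractBy b k (λ j → t j + contractBy c j n)
contractBy-swap (yes _) (yes _) _       _       _   _   _   _   _       _ = refl
contractBy-swap (yes _) (no _)  (yes _) _       _   _   _   _   zero    _ = refl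
contractBy-swap (yes _) (no _)  (yes _) _       _   _   _   _   (suc k) _ = refl
contractBy-swap (yes a) (no _)  (no ¬c) _       a⇒c _   _   _   _       _ = contradiction (a⇒c a) ¬c
contractBy-swap (no _)  (yes _) _       (yes _) _   _   _   _   zero    _ = refl
contractBy-swap (no _)  (yes _) _       (yes _) _   _   _   _   (suc k) _ = refl
contractBy-swap (no _)  (yes b) _       (no ¬d) _   b⇒d _   _   _       _ = contradiction (b⇒d b) ¬d
contractBy-swap (no _)  (no _)  _       _       _   _   _   _   zero    _ = refl
contractBy-swap (no ¬a) (no ¬b) c       d       _   _   d⇒c c⇒d (suc k) {s} {t} {m} {n} m≗n = begin
  t k + (s k + contractBy d k m) ≡⟨ sym (+-assoc (t k) (s k) _) ⟩
  t k + s k + contractBy d k m   ≡⟨ cong₂ _+_ (+-comm (t k) (s k))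
                                              (contractBy-cong d c (d⇒c ¬b) (c⇒d ¬a) k m≗n) ⟩
  s k + t k + contractBy c k n   ≡⟨ +-assoc (s k) (t k) _ ⟩
  s k + (t k + contractBy c k n) ∎
  where open ≡-Reasoning

count-swap : ∀ k (π : V → ℕ) e f es → count k π (e ∷ f ∷ es) ≡ count k π (f ∷ e ∷ es)
count-swap k π (u , v) (x , y) es = begin
  count k π es + contractBy (π x ≟ π y) k _ + _   ≡⟨ +-assoc (count k π es) _ _ ⟩
  count k π es + (contractBy (π x ≟ π y) k _ + _) ≡⟨ cong (count k π es +_)
    (contractBy-swap (π u ≟ π v) (π x ≟ π y)
      (merge π x y u ≟ merge π x y v) (merge π u v x ≟ merge π u v y)
      (ker⊆merge π x y) (ker⊆merge π u v)
      (merge-exchange π x y u v) (merge-exchange π u v x y) k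
      (λ j → count-cong (merge-comm π u v x y) (merge-comm π x y u v) j es)) ⟩
  count k π es + (contractBy (π u ≟ π v) k _ + _) ≡⟨ sym (+-assoc (count k π es) _ _) ⟩
  count k π es + contractBy (π u ≟ π v) k _ + _   ∎
  where open ≡-Reasoning

count-prep : (es fs : List (V × V)) → (∀ k π → count k π es ≡ count k π fs) →
             ∀ k (π : V → ℕ) e → count k π (e ∷ es) ≡ count k π (e ∷ fs)
count-prep es fs p k π (u , v) = cong₂ _+_ (p k π)
  (contractBy-cong (π u ≟ π v) (π u ≟ π v) id id k (λ j → p j (merge π u v)))

count-↭ : es ↭ fs → ∀ k (π : V → ℕ) → count k π es ≡ count k π fs
count-↭ refl         k π = refl
count-↭ (prep {es} {fs} e p) k π = count-prep es fs (count-↭ p) k π e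
count-↭ (swap {es} {fs} e f p) k π = trans (count-swap k π e f es)
  (count-prep (e ∷ es) (e ∷ fs) (λ k π → count-prep es fs (count-↭ p) k π e) k π f)
count-↭ (trans↭ p q) k π = trans (count-↭ p k π) (count-↭ q k π)

-- Numbered classes and correctness of the count

fin1-irrelevant : (i j : Fin 1) → i ≡ j
fin1-irrelevant zero zero = refl

-- Certifies that `π` has exactly `k + 1` classes by numbering them; the labels themselves are
-- arbitrary.
record Classes (k : ℕ) (π : V → ℕ) : Set where
  field
    class     : V → Fin (suc k)
    inhabited : ∀ i → ∃ λ x → class x ≡ i
    sound     : ∀ {x y} → class x ≡ class y → Ker π x y
    complete  : ∀ {x y} → Ker π x y → class x ≡ class y

private
  -- The quotient map gluing `b` to `a`: `b` goes where `a` goes, and `punchOut` closes the gap at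
  -- `b`.
  identify : {a b : Fin (suc (suc k))} → b ≢ a → Fin (suc (suc k)) → Fin (suc k)
  identify {b = b} b≢a x with b Fin.≟ x
  ... | yes _   = punchOut b≢a
  ... | no  b≢x = punchOut b≢x

  identify-joins : {a b : Fin (suc (suc k))} (b≢a : b ≢ a) → identify b≢a a ≡ identify b≢a b
  identify-joins {a = a} {b} b≢a with b Fin.≟ a | b Fin.≟ b
  ... | yes b≡a | _      = contradiction b≡a b≢a
  ... | no _    | yes _  = Fin.punchOut-cong b refl
  ... | no _    | no b≢b = contradiction refl b≢b

  identify-punchIn : {a b : Fin (suc (suc k))} (b≢a : b ≢ a) → ∀ i → identify b≢a (punchIn b i) ≡ i
  identify-punchIn {b = b} b≢a i with b Fin.≟ punchIn b i
  ... | yes b≡ = contradiction (sym b≡) (Fin.punchInᵢ≢i b i)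
  ... | no  b≢ = trans (Fin.punchOut-cong b refl) (Fin.punchOut-punchIn b)

  identify-kernel : {a b : Fin (suc (suc k))} (b≢a : b ≢ a) → ∀ x y →
                    identify b≢a x ≡ identify b≢a y →
                    x ≡ y ⊎ (x ≡ a × b ≡ y) ⊎ (b ≡ x × y ≡ a)
  identify-kernel {b = b} b≢a x y eq with b Fin.≟ x | b Fin.≟ y
  ... | yes b≡x | yes b≡y = inj₁ (trans (sym b≡x) b≡y)
  ... | yes b≡x | no  b≢y = inj₂ (inj₂ (b≡x , sym (Fin.punchOut-injective b≢a b≢y eq)))
  ... | no  b≢x | yes b≡y = inj₂ (inj₁ (Fin.punchOut-injective b≢x b≢a eq , b≡y))
  ... | no  b≢x | no  b≢y = inj₁ (Fin.punchOut-injective b≢x b≢y eq)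

-- Gluing the numbers of two separated classes loses exactly one. For `k = 0` everything lies in a
-- single class, which excludes a separated pair.
merge-classes : (π : V → ℕ) {u v : V} → ¬ Ker π u v → Classes k π →
                ∃ λ j → k ≡ suc j × Classes j (merge π u v)
merge-classes {k = zero} π u≁v C = contradiction (Classes.sound C (fin1-irrelevant _ _)) u≁v
merge-classes {k = suc k} π {u} {v} u≁v C = k , refl , record
  { class     = glue ∘ class
  ; inhabited = λ i → let x , p = inhabited (punchIn (class v) i) in
                      x , trans (cong glue p) (identify-punchIn v≢u i)
  ; sound     = λ {x} {y} p → to (identify-kernel v≢u (class x) (class y) p)
  ; complete  = merge-least (On.isEquivalence (glue ∘ class) isEquivalence)
                            {π} (cong glue ∘ complete) (identify-joins v≢u)
  }
  where
  open Classes C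
  v≢u : class v ≢ class u
  v≢u = u≁v ∘ sym ∘ sound
  glue = identify v≢u
  to : ∀ {x y} → class x ≡ class y ⊎ (class x ≡ class u × class v ≡ class y)
                                   ⊎ (class v ≡ class x × class y ≡ class u) →
       Ker (merge π u v) x y
  to (inj₁ p)              = ker⊆merge π u v (sound p)
  to (inj₂ (inj₁ (p , q))) = trans (ker⊆merge π u v (sound p))
                               (trans (merge-joins π u v) (ker⊆merge π u v (sound q)))
  to (inj₂ (inj₂ (p , q))) = trans (ker⊆merge π u v (sym (sound p)))
                               (trans (sym (merge-joins π u v)) (ker⊆merge π u v (sym (sound q))))

filter-map : {A B : Set} {P : B → Set} (P? : Decidable P) (f : A → B) → ∀ xs →
             filter P? (map f xs) ≡ map f (filter (P? ∘ f) xs)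
filter-map P? f []       = refl
filter-map P? f (x ∷ xs) with does (P? (f x))
... | true  = cong (f x ∷_) (filter-map P? f xs)
... | false = filter-map P? f xs

#subsets-suc : {P : Subset (suc n) → Set} (P? : Decidable P) →
               #subsets P? ≡ #subsets (P? ∘ (outside ∷_)) + #subsets (P? ∘ (inside ∷_))
#subsets-suc {n = n} P? = begin
  length (filter P? (map (outside ∷_) Fs ++ map (inside ∷_) Fs))
    ≡⟨ cong length (filter-++ P? (map (outside ∷_) Fs) _) ⟩
  length (filter P? (map (outside ∷_) Fs) ++ filter P? (map (inside ∷_) Fs))
    ≡⟨ length-++ (filter P? (map (outside ∷_) Fs)) ⟩
  length (filter P? (map (outside ∷_) Fs)) + length (filter P? (map (inside ∷_) Fs))
    ≡⟨ cong₂ _+_ (length-filter-map (outside ∷_)) (length-filter-map (inside ∷_)) ⟩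
  _ ∎
  where
  open ≡-Reasoning
  Fs = allSubsets n
  length-filter-map : ∀ f → length (filter P? (map f Fs)) ≡ length (filter (P? ∘ f) Fs)
  length-filter-map f = trans (cong length (filter-map P? f Fs)) (length-map f (filter (P? ∘ f) Fs))

#subsets-none : {P : Subset n → Set} (P? : Decidable P) → (∀ F → ¬ P F) → #subsets P? ≡ 0
#subsets-none {n = n} P? ¬p = cong length (filter-none P? (universal ¬p (allSubsets n)))

SpanningTree : (V → ℕ) → (es : List (V × V)) → Subset (length es) → Set
SpanningTree π es F = Forest π es F × (∀ x y → Ker (run π es F) x y)

-- Stating this for any `P` equivalent to `SpanningTree` lets the induction restrict `P?` by the
-- first edge, and lets one lemma count both trees and rooted forests. Once the edges run out,
-- connectedness means one class, which is what `0 ^ k` tests.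
#spanningTrees : (π : V → ℕ) (es : List (V × V)) → Classes k π →
                 {P : Subset (length es) → Set} (P? : Decidable P) →
                 (∀ F → P F → SpanningTree π es F) → (∀ F → SpanningTree π es F → P F) →
                 #subsets P? ≡ count k π es
#spanningTrees {k = zero} π [] C P? _ from =
  cong length (filter-accept P? (from [] (_ , λ x y → Classes.sound C (fin1-irrelevant _ _))))
#spanningTrees {k = suc k} π [] C P? to _ =
  #subsets-none P? λ { [] p → 0≢1 (to [] p) }
  where
  open Classes C
  0≢1 : ¬ SpanningTree π [] []
  0≢1 (_ , const) with inhabited zero | inhabited (suc zero)
  ... | x , p | y , q with trans (sym p) (trans (complete (const x y)) q)
  ... | ()
#spanningTrees {k = k} π ((u , v) ∷ es) C P? to from = trans (#subsets-suc P?)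
  (cong₂ _+_ (#spanningTrees π es C (P? ∘ (outside ∷_)) (to ∘ (outside ∷_)) (from ∘ (outside ∷_)))
             (with-edge (π u ≟ π v)))
  where
  with-edge : (d : Dec (Ker π u v)) →
              #subsets (P? ∘ (inside ∷_)) ≡ contractBy d k (λ j → count j (merge π u v) es)
  with-edge (yes u~v) = #subsets-none _ λ F p → proj₁ (proj₁ (to (inside ∷ F) p)) u~v
  with-edge (no u≁v) with merge-classes π u≁v C
  ... | j , refl , C′ = #spanningTrees (merge π u v) es C′ _
    (λ F p → let (_ , f) , c = to (inside ∷ F) p in f , c)
    (λ F (f , c) → from (inside ∷ F) ((u≁v , f) , c))

-- Components, cycles and forests

toℕ-next : (x : Fin (suc n)) → toℕ (next x) ≡ suc (toℕ x) % suc n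
toℕ-next x = Fin.toℕ-fromℕ< _

next-inject₁ : (i : Fin k) → next (inject₁ i) ≡ suc i
next-inject₁ {k} i = Fin.toℕ-injective (begin
  toℕ (next (inject₁ i))        ≡⟨ toℕ-next (inject₁ i) ⟩
  suc (toℕ (inject₁ i)) % suc k ≡⟨ cong (λ j → suc j % suc k) (Fin.toℕ-inject₁ i) ⟩
  suc (toℕ i) % suc k           ≡⟨ m<n⇒m%n≡m (s≤s (Fin.toℕ<n i)) ⟩
  suc (toℕ i)                   ∎)
  where open ≡-Reasoning

next-fromℕ : ∀ k → next (fromℕ k) ≡ zero
next-fromℕ k = Fin.toℕ-injective (begin
  toℕ (next (fromℕ k))        ≡⟨ toℕ-next (fromℕ k) ⟩
  suc (toℕ (fromℕ k)) % suc k ≡⟨ cong (λ j → suc j % suc k) (Fin.toℕ-fromℕ k) ⟩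
  suc k % suc k               ≡⟨ n%n≡0 (suc k) ⟩
  0                           ∎)
  where open ≡-Reasoning

∈-delete : {F : Subset n} {e f : Fin n} → e ≢ f → e ∈ F → e ∈ F [ f ]≔ outside
∈-delete {F = F} {e} {f} e≢f e∈F = []≔-minimal F e f e≢f e∈F

delete-⊆ : (F : Subset n) (f : Fin n) → (F [ f ]≔ outside) ⊆ F
delete-⊆ (_ ∷ F) zero    (there p) = there p
delete-⊆ (_ ∷ F) (suc f) here      = here
delete-⊆ (_ ∷ F) (suc f) (there p) = there (delete-⊆ F f p)

∉-delete : (F : Subset n) (e : Fin n) → e ∉ F [ e ]≔ outside
∉-delete (_ ∷ F) (suc e) (there p) = ∉-delete F e p

module _ {n : ℕ} (es : List (Fin n × Fin n)) where
  private
    G = multigraph n es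
  open Multigraph G

  joins-ends : ∀ e → Joins e (source es e) (target es e)
  joins-ends e = inj₁ refl

  joins-sym : ∀ {e u v} → Joins e u v → Joins e v u
  joins-sym = Sum.swap

  adjacent-kernel : (π : Vertex → ℕ) {F : EdgeSet} → Adjacent F ⇒ Ker (run π es F)
  adjacent-kernel π {F} (e , e∈F , inj₁ p) =
    subst (λ (u , v) → Ker (run π es F) u v) p (run-joins π es F e∈F)
  adjacent-kernel π {F} (e , e∈F , inj₂ p) =
    subst (λ (u , v) → Ker (run π es F) v u) p (sym (run-joins π es F e∈F))

  component⇒kernel : (π : Vertex → ℕ) {F : EdgeSet} → SameComponent F ⇒ Ker (run π es F)
  component⇒kernel π {F} =
    fold (Ker (run π es F)) (λ a p → trans (adjacent-kernel π {F} a) p) refl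

  component-isEquivalence : ∀ F → IsEquivalence (SameComponent F)
  component-isEquivalence F = record
    { refl = ε; sym = reverse λ (e , e∈F , p) → e , e∈F , joins-sym {e} p; trans = _◅◅_ }

  kernel⇒component : {F : EdgeSet} → Ker (run toℕ es F) ⇒ SameComponent F
  kernel⇒component {F} = run-least (component-isEquivalence F) {toℕ} es F
    (IsEquivalence.reflexive (component-isEquivalence F) ∘ Fin.toℕ-injective)
    (λ {e} e∈F → (e , e∈F , joins-ends e) ◅ ε)

  -- Indexed by length because a cycle is given by functions on `Fin (suc k)`.
  data Path (F : EdgeSet) : Vertex → Vertex → ℕ → Set where
    nil  : ∀ {x} → Path F x x 0
    step : ∀ {x y z k} e → e ∈ F → Joins e x y → Path F y z k → Path F x z (suc k)

  module _ {F : EdgeSet} where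

    vertices : ∀ {x y k} → Path F x y k → Fin (suc k) → Vertex
    vertices {x} _              zero    = x
    vertices     (step _ _ _ p) (suc i) = vertices p i

    Simple : ∀ {x y k} → Path F x y k → Set
    Simple nil                = ⊤
    Simple (step {x} _ _ _ p) = (∀ i → x ≢ vertices p i) × Simple p

    suffix : ∀ {x y k} (p : Path F x y k) → Simple p → ∀ i →
             ∃ λ j → ∃ λ (q : Path F (vertices p i) y j) → Simple q
    suffix p              s       zero    = _ , p , s
    suffix (step _ _ _ p) (_ , s) (suc i) = suffix p s i

    -- Loop erasure: if the new first vertex already lies on the simple path built for the rest, the
    -- path is cut back to that occurrence.
    simple-path : ∀ {x y} → SameComponent F x y → ∃ λ k → ∃ λ (p : Path F x y k) → Simple p
    simple-path ε = 0 , nil , _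
    simple-path {x} ((e , e∈F , j) ◅ w) with simple-path w
    ... | k , p , s with Fin.any? (λ i → x Fin.≟ vertices p i)
    ...   | yes (i , refl) = suffix p s i
    ...   | no  x∉p        = suc k , step e e∈F j p , (λ i x≡ → x∉p (i , x≡)) , s

    vertices-injective : ∀ {x y k} (p : Path F x y k) → Simple p → ∀ {i j} →
                         vertices p i ≡ vertices p j → i ≡ j
    vertices-injective p              s         {zero}  {zero}  _  = refl
    vertices-injective (step _ _ _ p) (x∉p , s) {zero}  {suc j} eq = contradiction eq (x∉p j)
    vertices-injective (step _ _ _ p) (x∉p , s) {suc i} {zero}  eq = contradiction (sym eq) (x∉p i)
    vertices-injective (step _ _ _ p) (x∉p , s) {suc i} {suc j} eq =
      cong suc (vertices-injective p s eq)

    last-vertex : ∀ {x y k} (p : Path F x y k) → vertices p (fromℕ k) ≡ y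
    last-vertex nil            = refl
    last-vertex (step _ _ _ p) = last-vertex p

    -- The edges of a path followed by the edge e, which is to close the path up.
    edges-with : Edge → ∀ {x y k} → Path F x y k → Fin (suc k) → Edge
    edges-with e nil            zero    = e
    edges-with e (step f _ _ p) zero    = f
    edges-with e (step _ _ _ p) (suc i) = edges-with e p i

    last-edge : ∀ e {x y k} (p : Path F x y k) → edges-with e p (fromℕ k) ≡ e
    last-edge e nil            = refl
    last-edge e (step _ _ _ p) = last-edge e p

    edges-∈ : ∀ e {x y k} (p : Path F x y k) (i : Fin k) → edges-with e p (inject₁ i) ∈ F
    edges-∈ e (step _ f∈F _ p) zero    = f∈F
    edges-∈ e (step _ _ _ p)   (suc i) = edges-∈ e p i

    edges-join : ∀ e {x y k} (p : Path F x y k) (i : Fin k) →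
                 Joins (edges-with e p (inject₁ i)) (vertices p (inject₁ i)) (vertices p (suc i))
    edges-join e (step _ _ j nil)            zero    = j
    edges-join e (step _ _ j (step _ _ _ _)) zero    = j
    edges-join e (step _ _ _ p)              (suc i) = edges-join e p i

    joins-unique : ∀ {e u v x y} → Joins e u v → Joins e x y → x ≡ u ⊎ x ≡ v
    joins-unique (inj₁ p) (inj₁ q) = inj₁ (cong proj₁ (trans (sym q) p))
    joins-unique (inj₁ p) (inj₂ q) = inj₂ (cong proj₂ (trans (sym q) p))
    joins-unique (inj₂ p) (inj₁ q) = inj₂ (cong proj₁ (trans (sym q) p))
    joins-unique (inj₂ p) (inj₂ q) = inj₁ (cong proj₂ (trans (sym q) p))

    -- If `f` recurred on `p`, its end `x` would be a vertex of `p`; and `f` is not the closing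
    -- edge, as that one lies outside `F`.
    first-edge-fresh : ∀ {e f} → e ∉ F → f ∈ F → ∀ {x y z k} (p : Path F y z k) →
                       (∀ i → x ≢ vertices p i) → Joins f x y → ∀ i → f ≢ edges-with e p i
    first-edge-fresh {e} {f} e∉F f∈F p x∉p j i eq with view i
    ... | ‵fromℕ     = e∉F (subst (_∈ F) (trans eq (last-edge e p)) f∈F)
    ... | ‵inject₁ i with joins-unique {f}
                           (subst (λ g → Joins g _ _) (sym eq) (edges-join e p i)) j
    ...   | inj₁ x≡ = x∉p (inject₁ i) x≡
    ...   | inj₂ x≡ = x∉p (suc i) x≡

    edges-injective : ∀ {e} → e ∉ F → ∀ {x y k} (p : Path F x y k) → Simple p → ∀ {i j} →
                      edges-with e p i ≡ edges-with e p j → i ≡ j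
    edges-injective e∉F nil s {zero} {zero} eq = refl
    edges-injective e∉F (step f _ _ p) _ {zero} {zero} eq = refl
    edges-injective e∉F (step f f∈F j p) (x∉p , s) {zero} {suc i} eq =
      contradiction eq (first-edge-fresh e∉F f∈F p x∉p j i)
    edges-injective e∉F (step f f∈F j p) (x∉p , s) {suc i} {zero} eq =
      contradiction (sym eq) (first-edge-fresh e∉F f∈F p x∉p j i)
    edges-injective e∉F (step _ _ _ p) (_ , s) {suc i} {suc j} eq =
      cong suc (edges-injective e∉F p s eq)

  -- The ends of `e` are joined without `e`, so `e` closes up a simple path that avoids it.
  redundant⇒cycle : ∀ {F} → Redundant toℕ es F → HasCycle G F
  redundant⇒cycle {F} (e , e∈F , r) with simple-path (kernel⇒component {F [ e ]≔ outside} r)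
  ... | k , p , s = k , vertices p , edges-with e p , isCycle
    (vertices-injective p s)
    (edges-injective (∉-delete F e) p s)
    edge∈F joins
    where
    edge∈F : ∀ i → edges-with e p i ∈ F
    edge∈F i with view i
    ... | ‵fromℕ     = subst (_∈ F) (sym (last-edge e p)) e∈F
    ... | ‵inject₁ i = delete-⊆ F e (edges-∈ e p i)
    joins : ∀ i → Joins (edges-with e p i) (vertices p i) (vertices p (next i))
    joins i with view i
    -- The path runs from the source of `e` to its target, so the closing edge is traversed
    -- backwards.
    ... | ‵fromℕ rewrite last-edge e p | last-vertex p | next-fromℕ k = joins-sym {e} (joins-ends e)
    ... | ‵inject₁ i rewrite next-inject₁ i = edges-join e p i

  -- Going the long way round the cycle joins the ends of edge 0 without using it, against
  -- irredundancy. A loop is covered too, its two ends being equal.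
  forest⇒acyclic : ∀ {F} → Forest toℕ es F → Acyclic G F
  forest⇒acyclic {F} f (k , v , d , isCycle v-inj d-inj d∈F j) =
    forest-irredundant es F f (d∈F zero) (ends-joined (j zero))
    where
    F′ = F [ d zero ]≔ outside
    ρ  = run toℕ es F′
    along : ∀ i → i ≢ zero → ρ (v i) ≡ ρ (v (next i))
    along i i≢0 = adjacent-kernel toℕ {F′} (d i , ∈-delete (i≢0 ∘ d-inj) (d∈F i) , j i)
    top : ∀ m → m ≡ k → ρ (v (fromℕ k)) ≡ ρ (v zero)
    top zero    refl = refl
    top (suc m) refl = trans (along (fromℕ k) λ ()) (cong (ρ ∘ v) (next-fromℕ k))
    descend : (i : Fin k) → ρ (v (suc i)) ≡ ρ (v zero) → ρ (v (inject₁ i)) ≡ ρ (v zero)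
    -- At index 0 the claim is trivial, so the descent never crosses the deleted edge.
    descend zero    _ = refl
    descend (suc i) p =
      trans (along (inject₁ (suc i)) λ ()) (trans (cong (ρ ∘ v) (next-inject₁ (suc i))) p)
    back : ρ (v (next zero)) ≡ ρ (v zero)
    back = >-weakInduction (λ i → ρ (v i) ≡ ρ (v zero)) (top k refl) descend (next zero)
    ends-joined : Joins (d zero) (v zero) (v (next zero)) →
                  Ker ρ (source es (d zero)) (target es (d zero))
    ends-joined (inj₁ p) = subst (λ (u , w) → Ker ρ u w) (sym p) (sym back)
    ends-joined (inj₂ p) = subst (λ (u , w) → Ker ρ u w) (sym p) back

  acyclic⇒forest : ∀ {F} → Acyclic G F → Forest toℕ es F
  acyclic⇒forest {F} a = irredundant⇒forest toℕ es F (a ∘ redundant⇒cycle)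

τ-count : ∀ k (es : List (Fin (suc k) × Fin (suc k))) → τ (multigraph (suc k) es) ≡ count k toℕ es
τ-count k es = #spanningTrees toℕ es
  record { class = id; inhabited = λ i → i , refl
         ; sound = cong toℕ; complete = Fin.toℕ-injective }
  (isSpanningTree? (multigraph (suc k) es))
  (λ F (a , c) → acyclic⇒forest es a , λ x y → component⇒kernel es toℕ (c x y))
  (λ F (f , c) → forest⇒acyclic es f , λ x y → kernel⇒component es (c x y))

-- Contraction of the root set

contract-∈ : (S : Subset n) {x : Fin n} → x ∈ S → contract S x ≡ zero
contract-∈ (inside ∷ S)  here        = refl
contract-∈ (inside ∷ S)  (there x∈S) = contract-∈ S x∈S
contract-∈ (outside ∷ S) (there x∈S) = cong (punchIn (suc zero)) (contract-∈ S x∈S)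

punchIn-1≡0 : (i : Fin (suc k)) → punchIn (suc zero) i ≡ zero → i ≡ zero
punchIn-1≡0 zero _ = refl

contract-zero : (S : Subset n) (x : Fin n) → contract S x ≡ zero → x ∈ S
contract-zero (inside ∷ S)  zero    _ = here
contract-zero (inside ∷ S)  (suc x) p = there (contract-zero S x p)
contract-zero (outside ∷ S) (suc x) p = there (contract-zero S x (punchIn-1≡0 _ p))

contract-kernel : (S : Subset n) (x y : Fin n) → contract S x ≡ contract S y →
                  x ≡ y ⊎ (x ∈ S × y ∈ S)
contract-kernel (inside ∷ S)  zero    zero    p = inj₁ refl
contract-kernel (inside ∷ S)  zero    (suc y) p = inj₂ (here , there (contract-zero S y (sym p)))
contract-kernel (inside ∷ S)  (suc x) zero    p = inj₂ (there (contract-zero S x p) , here)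
contract-kernel (inside ∷ S)  (suc x) (suc y) p with contract-kernel S x y p
... | inj₁ x≡y         = inj₁ (cong suc x≡y)
... | inj₂ (x∈S , y∈S) = inj₂ (there x∈S , there y∈S)
contract-kernel (outside ∷ S) zero    zero    p = inj₁ refl
contract-kernel (outside ∷ S) zero    (suc y) p =
  contradiction (sym p) (Fin.punchInᵢ≢i (suc zero) (contract S y))
contract-kernel (outside ∷ S) (suc x) zero    p =
  contradiction p (Fin.punchInᵢ≢i (suc zero) (contract S x))
contract-kernel (outside ∷ S) (suc x) (suc y) p
  with contract-kernel S x y (Fin.punchIn-injective (suc zero) _ _ p)
... | inj₁ x≡y         = inj₁ (cong suc x≡y)
... | inj₂ (x∈S , y∈S) = inj₂ (there x∈S , there y∈S)

contract-suc : (S : Subset n) (i : Fin ∣ ∁ S ∣) → ∃ λ x → contract S x ≡ suc i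
contract-suc (inside ∷ S)  i       = let x , p = contract-suc S i in suc x , p
contract-suc (outside ∷ S) zero    = zero , refl
contract-suc (outside ∷ S) (suc i) =
  let x , p = contract-suc S i in suc x , cong (punchIn (suc zero)) p

contraction : Subset n → Fin n → ℕ
contraction S = toℕ ∘ contract S

contraction-classes : (S : Subset n) {s : Fin n} → s ∈ S → Classes ∣ ∁ S ∣ (contraction S)
contraction-classes S {s} s∈S = record
  { class     = contract S
  ; inhabited = λ { zero → s , contract-∈ S s∈S ; (suc i) → contract-suc S i }
  ; sound     = cong toℕ
  ; complete  = Fin.toℕ-injective
  }

contraction-∈ : (S : Subset n) {x y : Fin n} → x ∈ S → y ∈ S → Ker (contraction S) x y
contraction-∈ S x∈S y∈S = cong toℕ (trans (contract-∈ S x∈S) (sym (contract-∈ S y∈S)))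

-- The equivalence generated by _~_ and the identification of all points of S.
Through : Subset n → Rel (Fin n) 0ℓ → Rel (Fin n) 0ℓ
Through S _~_ x y = x ~ y ⊎ ((∃ λ s → s ∈ S × x ~ s) × (∃ λ t → t ∈ S × y ~ t))

through-isEquivalence : (S : Subset n) {_~_ : Rel (Fin n) 0ℓ} →
                        IsEquivalence _~_ → IsEquivalence (Through S _~_)
through-isEquivalence S {_~_} E = record
  { refl  = inj₁ E.refl
  ; sym   = λ { (inj₁ p) → inj₁ (E.sym p) ; (inj₂ (p , q)) → inj₂ (q , p) }
  ; trans = trans′
  }
  where
  module E = IsEquivalence E
  trans′ : ∀ {x y z} → Through S _~_ x y → Through S _~_ y z → Through S _~_ x z
  trans′ (inj₁ p)                 (inj₁ q)                 = inj₁ (E.trans p q)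
  trans′ (inj₁ p)                 (inj₂ ((s , s∈S , q) , r)) = inj₂ ((s , s∈S , E.trans p q) , r)
  trans′ (inj₂ (p , t , t∈S , q)) (inj₁ r)                 = inj₂ (p , t , t∈S , E.trans (E.sym r) q)
  trans′ (inj₂ (p , _))           (inj₂ (_ , q))           = inj₂ (p , q)

module _ {n : ℕ} (es : List (Fin n × Fin n)) (S : Subset n) where
  private
    G = multigraph n es
    π = contraction S
  open Multigraph G

  toℕ⊆contraction : Ker toℕ ⇒ Ker π
  toℕ⊆contraction = cong π ∘ Fin.toℕ-injective

  -- By minimality of the run: `Through` yields an equivalence that contains the initial
  -- identification of `S` as well as every edge of `F`.
  contraction-kernel : ∀ F → Ker (run π es F) ⇒ Through S (Ker (run toℕ es F))
  contraction-kernel F = run-least (through-isEquivalence S ker) {π} es F base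
    (inj₁ ∘ run-joins toℕ es F)
    where
    ker = ker-isEquivalence (run toℕ es F)
    base : Ker π ⇒ Through S (Ker (run toℕ es F))
    base {x} {y} p with contract-kernel S x y (Fin.toℕ-injective p)
    ... | inj₁ refl        = inj₁ refl
    ... | inj₂ (x∈S , y∈S) = inj₂ ((x , x∈S , refl) , (y , y∈S , refl))

  rootedForest⇒spanningTree : ∀ F → IsRootedSpanningForest G S F → SpanningTree π es F
  rootedForest⇒spanningTree F (acyclic , root) = irredundant⇒forest π es F irredundant , connected
    where
    unique : ∀ {s t} → s ∈ S → t ∈ S → Ker (run toℕ es F) s t → s ≡ t
    unique {s} {t} s∈S t∈S s~t =
      let _ , _ , u = root s in
      trans (sym (u s (s∈S , ε))) (u t (t∈S , kernel⇒component es {F} s~t))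
    forest : Forest toℕ es F
    forest = acyclic⇒forest es acyclic
    irredundant : ¬ Redundant π es F
    irredundant (e , e∈F , r) with contraction-kernel (F [ e ]≔ outside) r
    ... | inj₁ p = forest-irredundant es F forest e∈F p
    -- Without `e` its two ends reach roots. Putting `e` back joins these roots, so they coincide,
    -- and then the ends of `e` were joined without it.
    ... | inj₂ ((s , s∈S , u~s) , (t , t∈S , v~t)) with unique s∈S t∈S
            (trans (sym (weaken u~s)) (trans (run-joins toℕ es F e∈F) (weaken v~t)))
      where
      weaken : Ker (run toℕ es (F [ e ]≔ outside)) ⇒ Ker (run toℕ es F)
      weaken = run-least (ker-isEquivalence (run toℕ es F)) {toℕ} es (F [ e ]≔ outside)
        (ker⊆run toℕ es F) (run-joins toℕ es F ∘ delete-⊆ F e)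
    ...   | refl = forest-irredundant es F forest e∈F (trans u~s (sym v~t))
    connected : ∀ x y → Ker (run π es F) x y
    connected x y =
      let s , (s∈S , x~s) , _ = root x
          t , (t∈S , y~t) , _ = root y
      in trans (component⇒kernel es π {F} x~s)
           (trans (ker⊆run π es F (contraction-∈ S s∈S t∈S)) (sym (component⇒kernel es π {F} y~t)))

  spanningTree⇒rootedForest : ∀ {s₀} → s₀ ∈ S → ∀ F → SpanningTree π es F →
                              IsRootedSpanningForest G S F
  spanningTree⇒rootedForest {s₀} s₀∈S F (forest , connected) =
    forest⇒acyclic es (forest-antitone es F toℕ⊆contraction forest) , λ x →
      let s , s∈S , x~s = root x in
      s , (s∈S , kernel⇒component es {F} x~s) ,
      λ t (t∈S , x~t) → unique s∈S t∈S (trans (sym x~s) (component⇒kernel es toℕ {F} x~t))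
    where
    root : ∀ x → ∃ λ s → s ∈ S × Ker (run toℕ es F) x s
    root x with contraction-kernel F (connected x s₀)
    ... | inj₁ x~s₀    = s₀ , s₀∈S , x~s₀
    ... | inj₂ (r , _) = r
    unique : ∀ {s t} → s ∈ S → t ∈ S → Ker (run toℕ es F) s t → s ≡ t
    unique {s} {t} s∈S t∈S s~t with s Fin.≟ t
    ... | yes s≡t = s≡t
    -- `F` is a forest over the contraction of all of `S`, hence also over the finer partition
    -- merging only `s` and `t`. So `F` cannot itself join them.
    ... | no  s≢t = contradiction s~t (forest-separates es F (s≢t ∘ Fin.toℕ-injective)
      (forest-antitone es F
        (merge-least (ker-isEquivalence π) {toℕ} toℕ⊆contraction (contraction-∈ S s∈S t∈S)) forest))

𝓕-contraction : (G : Multigraph) (S : Subset (Multigraph.order G)) → ∀ {s} → s ∈ S →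
                𝓕 G S ≡ count (∣ ∁ S ∣) (contraction S) (Multigraph.edges G)
𝓕-contraction G S s∈S = #spanningTrees (contraction S) (Multigraph.edges G)
  (contraction-classes S s∈S) (isRootedSpanningForest? G S)
  (rootedForest⇒spanningTree (Multigraph.edges G) S)
  (spanningTree⇒rootedForest (Multigraph.edges G) S s∈S)

nonLoops : List (Fin n × Fin n) → List (Fin n × Fin n)
nonLoops = filter (λ e → ¬? (proj₁ e Fin.≟ proj₂ e))

count-nonLoops : (es : List (Fin n × Fin n)) → ∀ k (π : Fin n → ℕ) →
                 count k π (nonLoops es) ≡ count k π es
count-nonLoops []             k π = refl
count-nonLoops ((u , v) ∷ es) k π with u Fin.≟ v
... | yes u≡v = trans (count-nonLoops es k π) (sym (count-loop k π u v es (cong π u≡v)))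
... | no  _   = count-prep (nonLoops es) es (count-nonLoops es) k π (u , v)

contractEdges : (S : Subset n) → List (Fin n × Fin n) →
                List (Fin (suc (∣ ∁ S ∣)) × Fin (suc (∣ ∁ S ∣)))
contractEdges S = map (Product.map (contract S) (contract S))

/-contractEdges : (es : List (Fin n × Fin n)) (S : Subset n) →
  multigraph n es / S ≡ multigraph (suc (∣ ∁ S ∣)) (nonLoops (contractEdges S es))
/-contractEdges es S = refl

τ-contraction : (G : Multigraph) (S : Subset (Multigraph.order G)) →
                τ (G / S) ≡ count (∣ ∁ S ∣) (contraction S) (Multigraph.edges G)
τ-contraction (multigraph n es) S =
  trans (cong τ (/-contractEdges es S)) (trans (τ-count (∣ ∁ S ∣) (nonLoops (contractEdges S es)))
    (trans (count-nonLoops (contractEdges S es) (∣ ∁ S ∣) toℕ)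
      (count-map (∣ ∁ S ∣) toℕ (contract S) es)))

-- Traversal of the wheel

-- What is left of a wheel traversed from a root: a is the label of the current
-- rim vertex and the list gives the labels of the next ones, 0 standing for the
-- identified roots.
fan : ℕ → List ℕ → List (ℕ × ℕ)
fan a []       = []
fan a (v ∷ vs) = (a , v) ∷ (0 , v) ∷ fan v vs

-- Roots share the label 0, so only nonzero labels are kept from repeating.
Distinct : List ℕ → Set
Distinct []           = ⊤
Distinct (zero ∷ vs)  = Distinct vs
Distinct (suc v ∷ vs) = All (suc v ≢_) vs × Distinct vs

nonRoots : List ℕ → ℕ
nonRoots []           = 0
nonRoots (zero ∷ vs)  = nonRoots vs
nonRoots (suc _ ∷ vs) = suc (nonRoots vs)

fan-map : ∀ f a vs → f 0 ≡ 0 → map (Product.map f f) (fan a vs) ≡ fan (f a) (map f vs)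
fan-map f a []       f0 = refl
fan-map f a (v ∷ vs) f0 = cong₂ _∷_ refl (cong₂ _∷_ (cong (_, f v) f0) (fan-map f v vs f0))

-- As `b` is neither 0 nor a later label, relabelling can affect the current vertex only.
fan-relabel : ∀ a b c vs → b ≢ 0 → All (b ≢_) vs →
              map (Product.map (relabel a b) (relabel a b)) (fan c vs) ≡ fan (relabel a b c) vs
fan-relabel a b c vs b≢0 b∉vs = trans (fan-map (relabel a b) c vs (relabel-other (b≢0 ∘ sym)))
  (cong (fan (relabel a b c)) (map-id-local (All.map (λ b≢x → relabel-other (b≢x ∘ sym)) b∉vs)))

-- Contracting an edge spends one class; the value at 0 agrees with `contractBy`.
delay : (ℕ → ℕ) → ℕ → ℕ
delay c zero    = 0
delay c (suc k) = c k

delay-cong : ∀ {c d} → (∀ j → c j ≡ d j) → ∀ k → delay c k ≡ delay d k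
delay-cong p zero    = refl
delay-cong p (suc k) = p k

-- The contraction is carried out on the edge list instead of the labelling, which stays `id`; what
-- remains can then be recognised as a fan again.
count-edge : ∀ {a b} → a ≢ b → ∀ k es →
  count k id ((a , b) ∷ es) ≡
  count k id es + delay (λ j → count j id (map (Product.map (relabel a b) (relabel a b)) es)) k
count-edge {a} {b} a≢b k es with a ≟ b
... | yes a≡b = contradiction a≡b a≢b
count-edge {a} {b} a≢b zero    es | no _ = refl
count-edge {a} {b} a≢b (suc k) es | no _ =
  cong (count (suc k) id es +_) (sym (count-map k id (relabel a b) es))

count-flip : ∀ k (π : ℕ → ℕ) a b es → count k π ((a , b) ∷ es) ≡ count k π ((b , a) ∷ es)
count-flip k π a b es = cong (count k π es +_)
  (contractBy-cong (π a ≟ π b) (π b ≟ π a) sym sym k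
    (λ j → count-cong (merge-sym π a b) (merge-sym π b a) j es))

-- The count `A` of the overview, with `k` kept variable; a fan from a nonzero label gives `B`.
centred : ℕ → List ℕ → ℕ
centred k vs = count k id (fan 0 vs)

centred-root : ∀ k vs → centred k (0 ∷ vs) ≡ centred k vs
centred-root k vs =
  trans (count-loop k id 0 0 ((0 , 0) ∷ fan 0 vs) refl) (count-loop k id 0 0 (fan 0 vs) refl)

spoke : ∀ {v} vs → v ≢ 0 → All (v ≢_) vs → ∀ k →
        count k id ((0 , v) ∷ fan v vs) ≡ count k id (fan v vs) + delay (λ j → centred j vs) k
spoke {v} vs v≢0 v∉vs k = trans (count-edge (v≢0 ∘ sym) k (fan v vs))
  (cong (count k id (fan v vs) +_) (delay-cong (λ j → cong (count j id)
    (trans (fan-relabel 0 v v vs v≢0 v∉vs) (cong (λ c → fan c vs) (relabel-right 0 v)))) k))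

-- Seen from a joined vertex, the rim edge to `v` and the spoke of `v` are parallel: either none is
-- taken and `v` becomes the pending vertex, or exactly one of the two is, since both close a cycle.
centred-nonRoot : ∀ {v} vs → v ≢ 0 → All (v ≢_) vs → ∀ k → centred k (v ∷ vs) ≡
                  count k id (fan v vs) + delay (λ j → centred j vs) k + delay (λ j → centred j vs) k
centred-nonRoot {v} vs v≢0 v∉vs k = trans (count-edge (v≢0 ∘ sym) k ((0 , v) ∷ fan v vs))
  (cong₂ _+_ (spoke vs v≢0 v∉vs k) (delay-cong contracted k))
  where
  contracted : ∀ j → count j id (map (Product.map (relabel 0 v) (relabel 0 v)) ((0 , v) ∷ fan v vs)) ≡
                     centred j vs
  contracted j rewrite fan-relabel 0 v v vs v≢0 v∉vs | relabel-right 0 v | relabel-left 0 v =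
    count-loop j id 0 0 (fan 0 vs) refl

-- The rim edge is flipped because relabel keeps its first argument, here 0.
pending-root : ∀ {a} vs → a ≢ 0 → All (a ≢_) vs → ∀ k →
               count k id (fan a (0 ∷ vs)) ≡ centred k vs + delay (λ j → centred j vs) k
pending-root {a} vs a≢0 a∉vs k = trans (count-flip k id a 0 ((0 , 0) ∷ fan 0 vs))
  (trans (count-edge (a≢0 ∘ sym) k ((0 , 0) ∷ fan 0 vs))
    (cong₂ _+_ (count-loop k id 0 0 (fan 0 vs) refl) (delay-cong contracted k)))
  where
  contracted : ∀ j → count j id (map (Product.map (relabel 0 a) (relabel 0 a)) ((0 , 0) ∷ fan 0 vs)) ≡
                     centred j vs
  contracted j rewrite fan-relabel 0 a 0 vs a≢0 a∉vs | relabel-left 0 a =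
    count-loop j id 0 0 (fan 0 vs) refl

-- The first two terms omit the rim edge, the last one takes it. In the latter case the merged pair
-- keeps the label `a`, and the spoke becomes a spoke of `a`.
pending-nonRoot : ∀ {a v} vs → a ≢ 0 → a ≢ v → All (a ≢_) vs → v ≢ 0 → All (v ≢_) vs → ∀ k →
  count k id (fan a (v ∷ vs)) ≡
  count k id (fan v vs) + delay (λ j → centred j vs) k +
  delay (λ j → count j id (fan a vs) + delay (λ i → centred i vs) j) k
pending-nonRoot {a} {v} vs a≢0 a≢v a∉vs v≢0 v∉vs k = trans (count-edge a≢v k ((0 , v) ∷ fan v vs))
  (cong₂ _+_ (spoke vs v≢0 v∉vs k) (delay-cong contracted k))
  where
  contracted : ∀ j → count j id (map (Product.map (relabel a v) (relabel a v)) ((0 , v) ∷ fan v vs)) ≡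
                     count j id (fan a vs) + delay (λ i → centred i vs) j
  contracted j rewrite fan-relabel a v v vs v≢0 v∉vs | relabel-right a v | relabel-other {a} (v≢0 ∘ sym) =
    spoke vs a≢0 a∉vs j

delay-vanish : ∀ {c m} → (∀ {k} → m < k → c k ≡ 0) → ∀ {k} → suc m < k → delay c k ≡ 0
delay-vanish p (s≤s m<k) = p m<k

mutual
  -- Each remaining non-root label can be merged away at most once, so a larger `k` ends at `0 ^ k`
  -- with a positive exponent. In `pending-vanish` the current vertex is one more such label.
  centred-vanish : ∀ vs → Distinct vs → ∀ {k} → nonRoots vs < k → centred k vs ≡ 0
  centred-vanish []           _          {suc k} _ = refl
  centred-vanish (zero ∷ vs)  d          {k} m<k = trans (centred-root k vs) (centred-vanish vs d m<k)
  centred-vanish (suc v ∷ vs) (v∉vs , d) {k} m<k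
    rewrite centred-nonRoot vs (λ ()) v∉vs k
          | pending-vanish v vs v∉vs d m<k
          | delay-vanish (centred-vanish vs d) m<k = refl

  pending-vanish : ∀ a vs → All (suc a ≢_) vs → Distinct vs → ∀ {k} → suc (nonRoots vs) < k →
                   count k id (fan (suc a) vs) ≡ 0
  pending-vanish a []           _              _          {suc k} _ = refl
  pending-vanish a (zero ∷ vs)  (_ ∷ a∉vs)     d          {k} m<k
    rewrite pending-root vs (λ ()) a∉vs k
          | centred-vanish vs d (<-trans (n<1+n _) m<k)
          | delay-vanish (centred-vanish vs d) m<k = refl
  pending-vanish a (suc v ∷ vs) (a≢v ∷ a∉vs) (v∉vs , d) {suc k} (s≤s m<k)
    rewrite pending-nonRoot vs (λ ()) a≢v a∉vs (λ ()) v∉vs (suc k)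
          | pending-vanish v vs v∉vs d (m≤n⇒m≤1+n m<k)
          | centred-vanish vs d (<-trans (n<1+n _) m<k)
          | pending-vanish a vs a∉vs d m<k
          | delay-vanish (centred-vanish vs d) m<k = refl

mutual
  -- `A` and `B` at the exact number of classes, where the terms with too large a `k` have dropped
  -- out and a linear recursion remains.
  centredTrees : List ℕ → ℕ
  centredTrees []           = 1
  centredTrees (zero ∷ vs)  = centredTrees vs
  centredTrees (suc _ ∷ vs) = pendingTrees vs + centredTrees vs + centredTrees vs

  pendingTrees : List ℕ → ℕ
  -- No edge is left to join the current vertex to the root.
  pendingTrees []           = 0
  pendingTrees (zero ∷ vs)  = centredTrees vs
  pendingTrees (suc _ ∷ vs) = pendingTrees vs + centredTrees vs

mutual
  centred-trees : ∀ vs → Distinct vs → centred (nonRoots vs) vs ≡ centredTrees vs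
  centred-trees []           _          = refl
  centred-trees (zero ∷ vs)  d          = trans (centred-root _ vs) (centred-trees vs d)
  centred-trees (suc v ∷ vs) (v∉vs , d)
    rewrite centred-nonRoot vs (λ ()) v∉vs (suc (nonRoots vs))
          | pending-trees v vs v∉vs d | centred-trees vs d = refl

  pending-trees : ∀ a vs → All (suc a ≢_) vs → Distinct vs →
                  count (suc (nonRoots vs)) id (fan (suc a) vs) ≡ pendingTrees vs
  pending-trees a []           _            _          = refl
  pending-trees a (zero ∷ vs)  (_ ∷ a∉vs)   d
    rewrite pending-root vs (λ ()) a∉vs (suc (nonRoots vs))
          | centred-vanish vs d (n<1+n _) = centred-trees vs d
  pending-trees a (suc v ∷ vs) (a≢v ∷ a∉vs) (v∉vs , d)
    rewrite pending-nonRoot vs (λ ()) a≢v a∉vs (λ ()) v∉vs (2 + nonRoots vs)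
          -- Without the rim edge the pending vertex is stranded: both terms ask for one merge more
          -- than is available.
          | pending-vanish v vs v∉vs d (n<1+n _)
          | centred-vanish vs d (n<1+n _)
          | pending-trees a vs a∉vs d | centred-trees vs d = refl

-- The rim as an orbit of the cyclic successor

iterate-∷ʳ : (f : A → A) (x : A) → ∀ n → List.iterate f x (suc n) ≡ List.iterate f x n ∷ʳ iterate f x n
iterate-∷ʳ f x zero    = refl
iterate-∷ʳ f x (suc n) = cong (x ∷_) (iterate-∷ʳ f (f x) n)

iterate-rotate : (f : A → A) (x : A) → ∀ n → iterate f x n ≡ x →
                 List.iterate f (f x) n ↭ List.iterate f x n
iterate-rotate f x zero    _ = ↭-refl
iterate-rotate f x (suc n) p = ↭-trans
  (↭-reflexive (trans (iterate-∷ʳ f (f x) n) (cong (List.iterate f (f x) n ∷ʳ_) p)))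
  (↭-sym (∷↭∷ʳ x (List.iterate f (f x) n)))

iterate-tabulate : (f : A → A) (x : A) → ∀ n →
                   List.iterate f x n ≡ tabulate {n = n} (iterate f x ∘ toℕ)
iterate-tabulate f x zero    = refl
iterate-tabulate f x (suc n) = cong (x ∷_) (iterate-tabulate f (f x) n)

%-absorbˡ : ∀ m n d .{{_ : NonZero d}} → (m % d + n) % d ≡ (m + n) % d
%-absorbˡ m n d = begin
  (m % d + n) % d         ≡⟨ %-distribˡ-+ (m % d) n d ⟩
  (m % d % d + n % d) % d ≡⟨ cong (λ i → (i + n % d) % d) (m%n%n≡m%n m d) ⟩
  (m % d + n % d) % d     ≡⟨ sym (%-distribˡ-+ m n d) ⟩
  (m + n) % d             ∎
  where open ≡-Reasoning

%-≡⇒∣ : ∀ m n d .{{_ : NonZero d}} → (m + n) % d ≡ m % d → d ∣ n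
%-≡⇒∣ m n d p = ∣m+n∣m⇒∣n (subst (d ∣_) quotients (n∣m*n ((m + n) div d))) (n∣m*n (m div d))
  where
  open ≡-Reasoning
  quotients : (m + n) div d * d ≡ m div d * d + n
  quotients = +-cancelˡ-≡ (m % d) _ _ (begin
    m % d + (m + n) div d * d       ≡⟨ cong (_+ (m + n) div d * d) (sym p) ⟩
    (m + n) % d + (m + n) div d * d ≡⟨ sym (m≡m%n+[m/n]*n (m + n) d) ⟩
    m + n                         ≡⟨ cong (_+ n) (m≡m%n+[m/n]*n m d) ⟩
    m % d + m div d * d + n         ≡⟨ +-assoc (m % d) (m div d * d) n ⟩
    m % d + (m div d * d + n)       ∎)

toℕ-iterate-next : (x : Fin (suc n)) → ∀ t → toℕ (iterate next x t) ≡ (toℕ x + t) % suc n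
toℕ-iterate-next {n} x zero = sym
  (trans (cong (_% suc n) (+-identityʳ (toℕ x))) (m<n⇒m%n≡m (Fin.toℕ<n x)))
toℕ-iterate-next {n} x (suc t) = begin
  toℕ (iterate next (next x) t)     ≡⟨ toℕ-iterate-next (next x) t ⟩
  (toℕ (next x) + t) % suc n        ≡⟨ cong (λ i → (i + t) % suc n) (toℕ-next x) ⟩
  (suc (toℕ x) % suc n + t) % suc n ≡⟨ %-absorbˡ (suc (toℕ x)) t (suc n) ⟩
  (suc (toℕ x) + t) % suc n         ≡⟨ cong (_% suc n) (sym (+-suc (toℕ x) t)) ⟩
  (toℕ x + suc t) % suc n           ∎
  where open ≡-Reasoning

next-periodic : (x : Fin N) → iterate next x N ≡ x
next-periodic {suc n} x = Fin.toℕ-injective (trans (toℕ-iterate-next x (suc n))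
  (trans ([m+n]%n≡m%n (toℕ x) (suc n)) (m<n⇒m%n≡m (Fin.toℕ<n x))))

iterate-next-zero : (x : Fin (suc n)) → iterate next zero (toℕ x) ≡ x
iterate-next-zero x = Fin.toℕ-injective
  (trans (toℕ-iterate-next zero (toℕ x)) (m<n⇒m%n≡m (Fin.toℕ<n x)))

-- From index 0 the iterates are `allFin` in order, and each further step of the starting point is a
-- rotation.
rim-from : (x : Fin N) → List.iterate next x N ↭ allFin N
rim-from {suc n} x = subst (λ y → List.iterate next y (suc n) ↭ allFin (suc n))
  (iterate-next-zero x) (rotate (toℕ x) zero zero-case)
  where
  zero-case : List.iterate next zero (suc n) ↭ allFin (suc n)
  zero-case = ↭-reflexive (trans (iterate-tabulate next zero (suc n)) (tabulate-cong iterate-next-zero))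
  rotate : ∀ t y → List.iterate next y (suc n) ↭ allFin (suc n) →
           List.iterate next (iterate next y t) (suc n) ↭ allFin (suc n)
  rotate zero    y p = p
  rotate (suc t) y p = rotate t (next y) (↭-trans (iterate-rotate next y (suc n) (next-periodic y)) p)

rimEdge spokeEdge : Fin N → Fin (suc N) × Fin (suc N)
rimEdge i   = suc i , suc (next i)
spokeEdge i = zero , suc i

walkEdges : Fin N → ℕ → List (Fin (suc N) × Fin (suc N))
walkEdges x zero    = []
walkEdges x (suc n) = rimEdge x ∷ spokeEdge (next x) ∷ walkEdges (next x) n

-- Each rim edge is followed by the spoke of its far end, so the spokes start one vertex later than
-- the rim edges.
walkEdges-↭ : (x : Fin N) → ∀ n →
              map rimEdge (List.iterate next x n) ++ map spokeEdge (List.iterate next (next x) n) ↭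
              walkEdges x n
walkEdges-↭ x zero    = ↭-refl
walkEdges-↭ x (suc n) = prep (rimEdge x)
  (↭-trans (shift (spokeEdge (next x)) (map rimEdge (List.iterate next (next x) n)) _)
           (prep (spokeEdge (next x)) (walkEdges-↭ (next x) n)))

wheel-↭ : (x : Fin N) → Multigraph.edges (wheel N) ↭ walkEdges x N
wheel-↭ {N} x = ↭-trans
  (++⁺ (map⁺ rimEdge (↭-sym (rim-from x))) (map⁺ spokeEdge (↭-sym (rim-from (next x)))))
  (walkEdges-↭ x N)

-- The same partition as `contraction S`, but a non-root gets a label that depends on its own index
-- alone.
label : Subset n → Fin n → ℕ
label S x with x ∈? S
... | yes _ = 0
... | no  _ = suc (toℕ x)

label-∈ : (S : Subset n) {x : Fin n} → x ∈ S → label S x ≡ 0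
label-∈ S {x} x∈S with x ∈? S
... | yes _  = refl
... | no x∉S = contradiction x∈S x∉S

label-∉ : (S : Subset n) {x : Fin n} → x ∉ S → label S x ≡ suc (toℕ x)
label-∉ S {x} x∉S with x ∈? S
... | yes x∈S = contradiction x∈S x∉S
... | no _    = refl

label-injective : (S : Subset n) {x y : Fin n} → Ker (label S) x y → label S x ≢ 0 → x ≡ y
label-injective S {x} {y} p ≢0 with x ∈? S | y ∈? S
... | yes _ | _     = contradiction refl ≢0
... | no _  | yes _ = contradiction p λ ()
... | no _  | no _  = Fin.toℕ-injective (suc-injective p)

contraction⊆label : (S : Subset n) → Ker (contraction S) ⇒ Ker (label S)
contraction⊆label S {x} {y} p with contract-kernel S x y (Fin.toℕ-injective p)
... | inj₁ refl        = refl
... | inj₂ (x∈S , y∈S) = trans (label-∈ S x∈S) (sym (label-∈ S y∈S))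

label⊆contraction : (S : Subset n) → Ker (label S) ⇒ Ker (contraction S)
label⊆contraction S {x} {y} p with x ∈? S | y ∈? S
... | yes x∈S | yes y∈S = contraction-∈ S x∈S y∈S
... | no _    | no _    = cong (contraction S) (Fin.toℕ-injective (suc-injective p))

module _ (R : Subset N) where
  private
    S = centreAnd R

  rimLabels : Fin N → ℕ → List ℕ
  rimLabels x n = map (label S ∘ suc) (List.iterate next x n)

  walkEdges-fan : ∀ x n → map (Product.map (label S) (label S)) (walkEdges x n) ≡
                          fan (label S (suc x)) (rimLabels (next x) n)
  walkEdges-fan x zero    = refl
  walkEdges-fan x (suc n) = cong₂ _∷_ refl (cong₂ _∷_ refl (walkEdges-fan (next x) n))

  -- Starting at a root makes the first label 0, so the fan begins in the joined state. The walk
  -- closes up at `x`, whose 0 comes last.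
  wheel-count : ∀ k {x} → x ∈ R →
                count k (contraction S) (Multigraph.edges (wheel N)) ≡ centred k (rimLabels (next x) N)
  wheel-count k {x} x∈R = begin
    count k (contraction S) (Multigraph.edges (wheel N))
      ≡⟨ count-cong (contraction⊆label S) (label⊆contraction S) k (Multigraph.edges (wheel N)) ⟩
    count k (label S) (Multigraph.edges (wheel N))
      ≡⟨ count-↭ (wheel-↭ x) k (label S) ⟩
    count k (label S) (walkEdges x N)
      ≡⟨ sym (count-map k id (label S) (walkEdges x N)) ⟩
    count k id (map (Product.map (label S) (label S)) (walkEdges x N))
      ≡⟨ cong (count k id) (walkEdges-fan x N) ⟩
    count k id (fan (label S (suc x)) (rimLabels (next x) N))
      ≡⟨ cong (λ a → count k id (fan a (rimLabels (next x) N))) (label-∈ S (there x∈R)) ⟩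
    centred k (rimLabels (next x) N) ∎
    where open ≡-Reasoning

  distinct-map : (f : Fin N → ℕ) → (∀ {x y} → f x ≡ f y → f x ≢ 0 → x ≡ y) →
                 ∀ {xs} → Unique xs → Distinct (map f xs)
  distinct-map f inj {[]} [] = _
  distinct-map f inj {x ∷ xs} (x∉xs ∷ u) with f x in eq
  ... | zero  = distinct-map f inj u
  ... | suc v = All.map⁺ (All.map (λ x≢y v≡ → x≢y (inj (trans eq v≡) fx≢0)) x∉xs) , distinct-map f inj u
    where
    fx≢0 : f x ≢ 0
    fx≢0 fx≡0 = contradiction (trans (sym eq) fx≡0) λ ()

  rimLabels-distinct : ∀ x → Distinct (rimLabels x N)
  rimLabels-distinct x = distinct-map (label S ∘ suc)
    (λ p ≢0 → Fin.suc-injective (label-injective S p ≢0))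
    (Unique-resp-↭ (setoid (Fin N)) (↭⇒↭ₛ (↭-sym (rim-from x))) (allFin⁺ N))

  -- Blocks between consecutive roots and Fibonacci numbers

  module _ {m a : ℕ} (q∣N : suc m ∣ N) (sound : ∀ x → x ∈ R → toℕ x % suc m ≡ a)
           (complete : ∀ x → toℕ x % suc m ≡ a → x ∈ R) where
    private
      q = suc m

    -- Wrapping around modulo `N` is invisible modulo its divisor `q`. The local `go` generalises
    -- `N`, which is fixed by `R`, so that it can be matched as a successor.
    next-residue : ∀ x t → (toℕ (next x) + t) % q ≡ (toℕ x + suc t) % q
    next-residue = go q∣N
      where
      go : ∀ {N} → q ∣ N → (x : Fin N) → ∀ t → (toℕ (next x) + t) % q ≡ (toℕ x + suc t) % q
      go {suc n} q∣N x t = begin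
        (toℕ (next x) + t) % q              ≡⟨ cong (λ i → (i + t) % q) (toℕ-next x) ⟩
        (suc (toℕ x) % suc n + t) % q       ≡⟨ sym (%-absorbˡ (suc (toℕ x) % suc n) t q) ⟩
        (suc (toℕ x) % suc n % q + t) % q   ≡⟨ cong (λ i → (i + t) % q)
                                                 (m∣n⇒o%n%m≡o%m q (suc n) (suc (toℕ x)) q∣N) ⟩
        (suc (toℕ x) % q + t) % q           ≡⟨ %-absorbˡ (suc (toℕ x)) t q ⟩
        (suc (toℕ x) + t) % q               ≡⟨ cong (_% q) (sym (+-suc (toℕ x) t)) ⟩
        (toℕ x + suc t) % q                 ∎
        where open ≡-Reasoning

    label-here : ∀ x → (toℕ x + 0) % q ≡ a → label S (suc x) ≡ 0
    label-here x p = label-∈ S (there (complete x (trans (cong (_% q) (sym (+-identityʳ (toℕ x)))) p)))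

    -- Were `x` a root, the residues would force `q` to divide `suc t`, which is smaller than `q`.
    label-before : ∀ x {t} → suc t < q → (toℕ x + suc t) % q ≡ a → label S (suc x) ≡ suc (suc (toℕ x))
    label-before x {t} t<q p = label-∉ S λ sx∈S →
      >⇒∤ t<q (%-≡⇒∣ (toℕ x) (suc t) q (trans p (sym (sound x (drop-there sx∈S)))))

    -- Here `t` is the distance to the next root. At the root both counts equal the count behind it,
    -- matching `fib 2` and `fib 1`; every non-root in front of it raises both Fibonacci indices by
    -- two.
    block : ∀ t n x → t < q → (toℕ x + t) % q ≡ a →
            let y = iterate next x (suc t) in
            centredTrees (rimLabels x (suc t + n)) ≡ fib (2 + (t + t)) * centredTrees (rimLabels y n) ×
            pendingTrees (rimLabels x (suc t + n)) ≡ fib (1 + (t + t)) * centredTrees (rimLabels y n) ×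
            nonRoots (rimLabels x (suc t + n)) ≡ t + nonRoots (rimLabels y n)
    block zero    n x _   p rewrite label-here x p = sym (+-identityʳ _) , sym (+-identityʳ _) , refl
    block (suc t) n x t<q p
      rewrite label-before x t<q p | +-suc t t
      with block t n (next x) (<-trans (n<1+n t) t<q) (trans (next-residue x t) p)
    ... | centre≡ , pending≡ , roots≡ rewrite centre≡ | pending≡ | roots≡ =
      trans (cong (_+ f₂ * c) (trans (sym (*-distribʳ-+ c f₁ f₂)) (cong (_* c) (+-comm f₁ f₂))))
            (sym (*-distribʳ-+ c (f₂ + f₁) f₂)) ,
      trans (sym (*-distribʳ-+ c f₁ f₂)) (cong (_* c) (+-comm f₁ f₂)) ,
      refl
      where
      f₁ = fib (1 + (t + t))
      f₂ = fib (2 + (t + t))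
      c  = centredTrees (rimLabels (iterate next (next x) (suc t)) n)

    iterate-residue : ∀ x t s → (toℕ (iterate next x t) + s) % q ≡ (toℕ x + (t + s)) % q
    iterate-residue x zero    s = refl
    iterate-residue x (suc t) s = trans (iterate-residue (next x) t s) (next-residue x (t + s))

    -- The hypothesis puts `x` just behind a root. A block consists of `m` non-roots and a root, and
    -- its `q` steps restore the residue.
    blocks : ∀ r x → (toℕ x + m) % q ≡ a →
             centredTrees (rimLabels x (r * q)) ≡ fib (2 * q) ^ r ×
             nonRoots (rimLabels x (r * q)) ≡ r * m
    blocks zero    x _ = refl , refl
    blocks (suc r) x p with block m (r * q) x (n<1+n m) p
    ... | centre≡ , _ , roots≡ with blocks r (iterate next x (suc m)) shifted
      where
      shifted : (toℕ (iterate next x (suc m)) + m) % q ≡ a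
      shifted = begin
        (toℕ (iterate next x q) + m) % q ≡⟨ iterate-residue x q m ⟩
        (toℕ x + (q + m)) % q            ≡⟨ cong (λ i → (toℕ x + i) % q) (+-comm q m) ⟩
        (toℕ x + (m + q)) % q            ≡⟨ cong (_% q) (sym (+-assoc (toℕ x) m q)) ⟩
        (toℕ x + m + q) % q              ≡⟨ [m+n]%n≡m%n (toℕ x + m) q ⟩
        (toℕ x + m) % q                  ≡⟨ p ⟩
        a                                ∎
        where open ≡-Reasoning
    ...   | trees≡ , count≡ = trans centre≡ (cong₂ _*_ (cong fib double) trees≡)
                            , trans roots≡ (cong (m +_) count≡)
      where
      double : 2 + (m + m) ≡ 2 * q
      double = trans (cong suc (sym (+-suc m m))) (cong (λ i → q + suc i) (sym (+-identityʳ m)))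

    periodic-count : ∀ r → N ≡ r * q → ∀ {x} → x ∈ R →
                     count (r * m) (contraction S) (Multigraph.edges (wheel N)) ≡ fib (2 * q) ^ r
    periodic-count r N≡rq {x} x∈R with blocks r (next x) next-to-root
      where
      next-to-root : (toℕ (next x) + m) % q ≡ a
      next-to-root = trans (next-residue x m) (trans ([m+n]%n≡m%n (toℕ x) q) (sound x x∈R))
    ... | trees≡ , roots≡ = begin
      count (r * m) (contraction S) (Multigraph.edges (wheel N)) ≡⟨ wheel-count (r * m) x∈R ⟩
      centred (r * m) vs         ≡⟨ cong (λ k → centred k vs)
                                      (sym (trans (cong (nonRoots ∘ rimLabels (next x)) N≡rq) roots≡)) ⟩
      centred (nonRoots vs) vs   ≡⟨ centred-trees vs (rimLabels-distinct (next x)) ⟩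
      centredTrees vs            ≡⟨ cong (centredTrees ∘ rimLabels (next x)) N≡rq ⟩
      centredTrees (rimLabels (next x) (r * q)) ≡⟨ trees≡ ⟩
      fib (2 * q) ^ r            ∎
      where
      open ≡-Reasoning
      vs = rimLabels (next x) N

-- Root sets with equal cyclic intervals

-- A named copy of the local recursion of `cyclicIntervals`, open to induction.
gaps : ℕ → ℕ → ℕ → List ℕ → List ℕ
gaps N a₁ a []       = (a₁ + N ∸ a) ∷ []
gaps N a₁ a (b ∷ bs) = (b ∸ a) ∷ gaps N a₁ b bs

intervals : ℕ → List ℕ → List ℕ
intervals N []       = []
intervals N (a ∷ as) = gaps N a a as

mutual
  cyclicIntervals-indices : ∀ {N} (R : Subset N) → cyclicIntervals R ≡ intervals N (indices R)
  cyclicIntervals-indices R with indices R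
  ... | []         = refl
  ... | a ∷ []     = refl
  ... | a ∷ b ∷ bs = cong ((b ∸ a) ∷_) (gaps-unfold R a b bs)

  -- The left-hand side is the local function of cyclicIntervals, which has no
  -- name here; it is inferred from the use above.
  gaps-unfold : ∀ {N} (R : Subset N) a₁ a bs → _ ≡ gaps N a₁ a bs
  gaps-unfold R a₁ a []       = refl
  gaps-unfold R a₁ a (b ∷ bs) = cong ((b ∸ a) ∷_) (gaps-unfold R a₁ b bs)

∸≡suc : ∀ m n {o} → m ∸ n ≡ suc o → m ≡ n + suc o
∸≡suc m n p = trans (sym (m+[n∸m]≡n (<⇒≤ (m∸n≢0⇒n<m {m} {n} m∸n≢0)))) (cong (n +_) p)
  where
  m∸n≢0 : m ∸ n ≢ 0
  m∸n≢0 z = contradiction (trans (sym p) z) λ ()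

-- The list runs through an arithmetic progression of step `q`, and `total` is the term that would
-- follow: here the first root one full turn later.
record Progression (q total a : ℕ) (as : List ℕ) : Set where
  field
    wraps    : total ≡ a + length as * q
    elements : ∀ {x} → x ∈ₗ as → ∃ λ j → x ≡ a + j * q
    includes : ∀ {j} → j < length as → (a + j * q) ∈ₗ as

gaps-progression : ∀ {N m} a₁ a bs → All (_≡ suc m) (gaps N a₁ a bs) →
                   Progression (suc m) (a₁ + N) a (a ∷ bs)
gaps-progression {m = m} a₁ a [] (p ∷ []) = record
  { wraps    = trans (∸≡suc (a₁ + _) a p) (cong (a +_) (sym (+-identityʳ (suc m))))
  ; elements = λ { (here refl) → 0 , sym (+-identityʳ a) }
  ; includes = λ { {zero} _ → here (+-identityʳ a) ; {suc j} (s≤s ()) }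
  }
gaps-progression {m = m} a₁ a (b ∷ bs) (p ∷ ps) with ∸≡suc b a p | gaps-progression a₁ b bs ps
... | refl | P = record
  { wraps    = trans P.wraps (+-assoc a (suc m) _)
  ; elements = λ { (here refl) → 0 , sym (+-identityʳ a)
                 ; (there x∈)  → let j , eq = P.elements x∈ in
                                 suc j , trans eq (+-assoc a (suc m) (j * suc m)) }
  ; includes = λ { {zero}  _         → here (+-identityʳ a)
                 ; {suc j} (s≤s j<) → there (subst (_∈ₗ (b ∷ bs))
                                              (+-assoc a (suc m) (j * suc m)) (P.includes j<)) }
  }
  where module P = Progression P

∈⇒index : ∀ {N} (R : Subset N) {x} → x ∈ R → toℕ x ∈ₗ indices R
∈⇒index R x∈R = ∈-map⁺ toℕ (∈-filter⁺ (_∈? R) (∈-allFin _) x∈R)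

index⇒∈ : ∀ {N} (R : Subset N) {i} → i ∈ₗ indices R → ∃ λ x → i ≡ toℕ x × x ∈ R
index⇒∈ {N} R i∈ with ∈-map⁻ toℕ i∈
... | x , x∈ , i≡ = x , i≡ , proj₂ (∈-filter⁻ (_∈? R) {xs = allFin N} x∈)

Residues : ∀ {N} (q : ℕ) .{{_ : NonZero q}} → ℕ → Subset N → Set
Residues q a R = (∀ x → x ∈ R → toℕ x % q ≡ a) × (∀ x → toℕ x % q ≡ a → x ∈ R)

-- The indices form a progression of step `q` that closes up after `N`. The residue is the first
-- index, which is below `q`.
equalIntervals⇒residues : ∀ {N m} (R : Subset N) {x} → x ∈ R → All (_≡ suc m) (cyclicIntervals R) →
                          ∃ λ a → Residues (suc m) a R
equalIntervals⇒residues {N} {m} R x∈R regular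
  with indices R in eq | subst (All (_≡ suc m)) (cyclicIntervals-indices R) regular
... | []     | _ = contradiction (subst (_ ∈ₗ_) eq (∈⇒index R x∈R)) λ ()
... | a ∷ as | p = a , sound , complete
  where
  q = suc m
  open Progression (gaps-progression a a as p)
  N≡ : N ≡ q + length as * q
  N≡ = +-cancelˡ-≡ a N _ wraps
  member : ∀ {j} → j < suc (length as) → ∃ λ y → a + j * q ≡ toℕ y × y ∈ R
  member {j} j< = index⇒∈ R (subst (a + j * q ∈ₗ_) (sym eq) (includes j<))
  a<q : a < q
  a<q with member (n<1+n (length as))
  -- The last root, `a + length as * q`, lies below `N = q + length as * q`.
  ... | y , y≡ , _ = +-cancelʳ-< (length as * q) a q (subst₂ _<_ (sym y≡) N≡ (Fin.toℕ<n y))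
  sound : ∀ x → x ∈ R → toℕ x % q ≡ a
  sound x x∈R with elements (subst (toℕ x ∈ₗ_) eq (∈⇒index R x∈R))
  ... | j , x≡ = trans (cong (_% q) x≡) (trans ([m+kn]%n≡m%n a j q) (m<n⇒m%n≡m a<q))
  complete : ∀ x → toℕ x % q ≡ a → x ∈ R
  complete x p
    -- The quotient of `toℕ x` by `q` is the position of `x` in the progression.
    with member (m<n*o⇒m/o<n {toℕ x} {suc (length as)} {q} (subst (toℕ x <_) N≡ (Fin.toℕ<n x)))
  ... | y , y≡ , y∈R = subst (_∈ R) (sym (Fin.toℕ-injective
    (trans (m≡m%n+[m/n]*n (toℕ x) q) (trans (cong (_+ toℕ x div q * q) p) y≡)))) y∈R

nonempty : ∀ {N} (R : Subset N) → 1 ≤ ∣ R ∣ → ∃ (_∈ R)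
nonempty {N} R 1≤ with Fin.any? (_∈? R)
... | yes x∈R = x∈R
... | no ¬x   = contradiction (trans (cong ∣_∣ (Empty-unique ¬x)) (∣⊥∣≡0 N)) (>⇒≢ 1≤)

corollary3p6 : (N r q : ℕ) → 3 ≤ N → 1 ≤ r → 1 ≤ q → N ≡ r * q →
    (R : Subset N) → ∣ R ∣ ≡ r → All (_≡ q) (cyclicIntervals R) →
    𝓕 (wheel N) (centreAnd R) ≡ τ (wheel N / centreAnd R) ×
    τ (wheel N / centreAnd R) ≡ fib (2 * q) ^ r
corollary3p6 N r (suc m) _ 1≤r _ N≡rq R ∣R∣≡r regular =
  -- Forests and trees are given by the same `count`; the centre shows that the root set is
  -- nonempty.
  trans (𝓕-contraction (wheel N) (centreAnd R) here) (sym (τ-contraction (wheel N) (centreAnd R))) ,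
  trans (τ-contraction (wheel N) (centreAnd R)) count≡
  where
  S = centreAnd R
  edges = Multigraph.edges (wheel N)
  -- The centre is a root, so `∁ S` and `∁ R` have equal size, namely `r * q - r`.
  nonRoots≡ : ∣ ∁ R ∣ ≡ r * m
  nonRoots≡ = trans (∣∁p∣≡n∸∣p∣ R) (trans (cong₂ _∸_ (trans N≡rq (*-suc r m)) ∣R∣≡r)
                                        (m+n∸m≡n r (r * m)))
  count≡ : count (∣ ∁ R ∣) (contraction S) edges ≡ fib (2 * suc m) ^ r
  count≡ with nonempty R (subst (1 ≤_) (sym ∣R∣≡r) 1≤r)
  ... | x , x∈R with equalIntervals⇒residues R x∈R regular
  ...   | a , sound , complete = trans (cong (λ k → count k (contraction S) edges) nonRoots≡)
    (periodic-count R (divides r N≡rq) sound complete r N≡rq x∈R)
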